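{- Let $\mathcal C$ be a cartesian $R$-differential category, where $R$ has multiplicative inverses for integers. For all $n,m\in\mathbb N$ and $r\in R$, the following families of morphisms are natural transformations between functors on $\mathcal C$: $\iota_n:\mathrm{Id}\Rightarrow T_n$, $\theta_n:T_nT_n\Rightarrow T_n$, $c_{n,m}:T_nT_m\Rightarrow T_mT_n$, and $m_n(r):T_n\Rightarrow T_n$.
   Context: $R$ is a commutative semiring with multiplicative inverses for integers: for each integer $n\ge1$ there is $\frac1n\in R$ with $\frac1n\cdot(1_R+\cdots+1_R)=1_R$ ($n$ summands). A map between $R$-semimodules is $R$-additive if it preserves sums, $0$ and the action of $R$. A left $R$-additive category is a category $\mathcal C$ whose hom-sets are $R$-semimodules and such that every precomposition map $\_\circ f$ is $R$-additive; a morphism $h:Y\to Z$ is $R$-additive if every postcomposition map $h\circ\_:\mathcal C(X,Y)\to\mathcal C(X,Z)$ is $R$-additive. A cartesian left $R$-additive category is one with finite products whose projections are $R$-additive. $\langle\cdots\rangle$ denotes tupling. Put $SX=X\times X$ with projections $\pi_0,\pi_1:SX\to X$. A derivative is a family of operators $D:\mathcal C(X,Y)\to\mathcal C(SX,Y)$ such that: (i) $Dp=p\circ\pi_1$ for every product projection $p:X_0\times\cdots\times X_n\to X_i$; (ii) $D$ is $R$-additive; (iii) $D\,\mathrm{id}=\pi_1$ and $D(g\circ f)=Dg\circ\langle f\circ\pi_0,Df\rangle$; (iv) $Df$ is $R$-additive in its second argument, i.e. $u\mapsto Df\circ\langle x,u\rangle$ is $R$-additive; (v) $DDf\circ\langle\langle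 x,0\rangle,\langle 0,u\rangle\rangle=Df\circ\langle x,u\rangle$; (vi) $DDf\circ\langle\langle x,u\rangle,\langle v,w\rangle\rangle=DDf\circ\langle\langle x,v\rangle,\langle u,w\rangle\rangle$. A cartesian $R$-differential category is a cartesian left $R$-additive category with a derivative. $S_nX=X^{n+1}$ with projections $\pi_0,\dots,\pi_n:S_nX\to X$; for $m\le n$, $s_{n\to m}=\langle\pi_0,\dots,\pi_m\rangle:S_nX\to S_mX$. For $n\ge1$, $\nu_n=\langle\langle\pi_0,\dots,\pi_{n-1}\rangle,\langle\tfrac1n\pi_1,\tfrac2n\pi_2,\dots,\tfrac nn\pi_n\rangle\rangle:S_nX\to SS_{n-1}X$. For $f\in\mathcal C(X,Y)$ define $t_nf:S_nX\to Y$ by $t_0f=f$, $t_{n+1}f=D(t_nf)\circ\nu_{n+1}$. The functor $T_n$ on $\mathcal C$ is given by $T_nX=S_nX$ and, for $f:X\to Y$, $\pi_i\circ T_nf=t_if\circ s_{n\to i}$ for $0\le i\le n$. The families $\iota_n:X\to S_nX$, $\theta_n:S_nS_nX\to S_nX$, $c_{n,m}:S_nS_mX\to S_mS_nX$, $m_n(r):S_nX\to S_nX$ are characterized by: $\pi_k\circ\iota_n=\mathrm{id}$ if $k=0$ and $0$ otherwise; $\pi_k\circ\theta_n=\sum_{i+j=k}\pi_i\circ\pi_j$; $\pi_i\circ\pi_j\circ c_{n,m}=\pi_j\circ\pi_i$ for $0\le i\le n$, $0\le j\le m$; $\pi_k\circ m_n(r)=r^k\pi_k$. (In a composite of projections the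 right-most one projects the outermost functor.) -}

module Defs where

open import Algebra.Bundles using (CommutativeSemiring)
open import Algebra.Module.Bundles using (LeftSemimodule)
open import Algebra.Module.Bundles.Raw using (RawLeftSemimodule)
open import Algebra.Module.Morphism.Structures using (module LeftSemimoduleMorphisms)
open import Algebra.Module.Structures using (IsLeftSemimodule)
import Algebra.Definitions.RawMonoid as RawMonoidDefinitions
import Algebra.Definitions.RawSemiring as RawSemiringDefinitions
open import Data.Fin.Base using (Fin; zero; suc; toℕ; inject₁; inject≤; opposite; fromℕ)
open import Data.Fin.Properties
  using (toℕ<n; toℕ≤pred[n]; toℕ-inject₁; toℕ-inject≤; toℕ-fromℕ; toℕ-injective)
open import Data.Nat.Base using (ℕ; zero; suc; _≤_; s≤s; NonZero)
open import Data.Nat.Properties using (≤-refl; ≤-trans; n≤1+n)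
open import Data.Vec.Functional using (Vector; head; tail)
open import Function.Base using (id)
open import Level using (Level; _⊔_) renaming (suc to lsuc)
open import Relation.Binary.Bundles using (Setoid)
open import Relation.Binary.Core using (Rel)
open import Relation.Binary.PropositionalEquality.Core as ≡ using (_≡_)
open import Relation.Binary.Structures using (IsEquivalence)
import Relation.Binary.Reasoning.Setoid as SetoidReasoning

record Category o ℓ e : Set (lsuc (o ⊔ ℓ ⊔ e)) where
  infix  4 _≈_
  infixr 9 _∘_
  field
    Obj       : Set o
    Hom       : Obj → Obj → Set ℓ
    _≈_       : ∀ {X Y} → Rel (Hom X Y) e
    idm       : ∀ {X} → Hom X X
    _∘_       : ∀ {X Y Z} → Hom Y Z → Hom X Y → Hom X Z
    equiv     : ∀ {X Y} → IsEquivalence (_≈_ {X} {Y})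
    assoc     : ∀ {W X Y Z} {f : Hom W X} {g : Hom X Y} {h : Hom Y Z} →
                (h ∘ g) ∘ f ≈ h ∘ (g ∘ f)
    identityˡ : ∀ {X Y} {f : Hom X Y} → idm ∘ f ≈ f
    identityʳ : ∀ {X Y} {f : Hom X Y} → f ∘ idm ≈ f
    ∘-cong    : ∀ {X Y Z} {g g′ : Hom Y Z} {f f′ : Hom X Y} →
                g ≈ g′ → f ≈ f′ → g ∘ f ≈ g′ ∘ f′

  homSetoid : ∀ X Y → Setoid ℓ e
  homSetoid X Y = record { isEquivalence = equiv {X} {Y} }

  module ≈ {X} {Y} = Setoid (homSetoid X Y)

record Functor {o ℓ e o′ ℓ′ e′} (𝒞 : Category o ℓ e) (𝒟 : Category o′ ℓ′ e′)
               : Set (o ⊔ ℓ ⊔ e ⊔ o′ ⊔ ℓ′ ⊔ e′) where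
  private
    module C = Category 𝒞
    module D = Category 𝒟
  field
    F₀   : C.Obj → D.Obj
    F₁   : ∀ {X Y} → C.Hom X Y → D.Hom (F₀ X) (F₀ Y)
    cong : ∀ {X Y} {f g : C.Hom X Y} → f C.≈ g → F₁ f D.≈ F₁ g
    idm  : ∀ {X} → F₁ (C.idm {X}) D.≈ D.idm
    homo : ∀ {X Y Z} (g : C.Hom Y Z) (f : C.Hom X Y) →
           F₁ (g C.∘ f) D.≈ F₁ g D.∘ F₁ f

module _ {o ℓ e} {𝒞 : Category o ℓ e} where
  open Category 𝒞

  Id : Functor 𝒞 𝒞
  Id = record
    { F₀ = id ; F₁ = id ; cong = id
    ; idm = ≈.refl ; homo = λ _ _ → ≈.refl }

  infixr 9 _∘F_
  _∘F_ : Functor 𝒞 𝒞 → Functor 𝒞 𝒞 → Functor 𝒞 𝒞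
  G ∘F F = record
    { F₀   = λ X → G.F₀ (F.F₀ X)
    ; F₁   = λ f → G.F₁ (F.F₁ f)
    ; cong = λ eq → G.cong (F.cong eq)
    ; idm  = ≈.trans (G.cong F.idm) G.idm
    ; homo = λ g f → ≈.trans (G.cong (F.homo g f)) (G.homo _ _)
    }
    where
      module F = Functor F
      module G = Functor G

  IsNatural : (F G : Functor 𝒞 𝒞) →
              (∀ X → Hom (Functor.F₀ F X) (Functor.F₀ G X)) → Set (o ⊔ ℓ ⊔ e)
  IsNatural F G η = ∀ {X Y} (f : Hom X Y) → η Y ∘ F.F₁ f ≈ G.F₁ f ∘ η X
    where
      module F = Functor F
      module G = Functor G

record FiniteProducts {o ℓ e} (𝒞 : Category o ℓ e) : Set (o ⊔ ℓ ⊔ e) where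
  open Category 𝒞
  infixr 7 _×_
  field
    ⊤        : Obj
    !        : ∀ {X} → Hom X ⊤
    !-unique : ∀ {X} (f : Hom X ⊤) → f ≈ !

    _×_      : Obj → Obj → Obj
    π₀       : ∀ {X Y} → Hom (X × Y) X
    π₁       : ∀ {X Y} → Hom (X × Y) Y
    ⟨_,_⟩    : ∀ {X Y Z} → Hom Z X → Hom Z Y → Hom Z (X × Y)
    project₀ : ∀ {X Y Z} {f : Hom Z X} {g : Hom Z Y} → π₀ ∘ ⟨ f , g ⟩ ≈ f
    project₁ : ∀ {X Y Z} {f : Hom Z X} {g : Hom Z Y} → π₁ ∘ ⟨ f , g ⟩ ≈ g
    unique   : ∀ {X Y Z} {f : Hom Z X} {g : Hom Z Y} {h : Hom Z (X × Y)} →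
               π₀ ∘ h ≈ f → π₁ ∘ h ≈ g → h ≈ ⟨ f , g ⟩

  -- The product X₀ × (X₁ × ⋯ × Xₙ).  Unary products are X₀ itself, so that
  -- X¹ = X and X² = X × X hold on the nose.
  Π : ∀ {n} → Vector Obj (suc n) → Obj
  Π {zero}  X = head X
  Π {suc n} X = head X × Π (tail X)

  π : ∀ {n} {X : Vector Obj (suc n)} (i : Fin (suc n)) → Hom (Π X) (X i)
  π {zero}  zero    = idm
  π {suc n} zero    = π₀
  π {suc n} (suc i) = π i ∘ π₁

  tuple : ∀ {n} {X : Vector Obj (suc n)} {Z} →
          ((i : Fin (suc n)) → Hom Z (X i)) → Hom Z (Π X)
  tuple {zero}  f = f zero
  tuple {suc n} f = ⟨ f zero , tuple (λ i → f (suc i)) ⟩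

  π-tuple : ∀ {n} {X : Vector Obj (suc n)} {Z} (f : ∀ i → Hom Z (X i)) i →
            π {X = X} i ∘ tuple f ≈ f i
  π-tuple {zero}  f zero    = identityˡ
  π-tuple {suc n} f zero    = project₀
  π-tuple {suc n} f (suc i) =
    ≈.trans assoc (≈.trans (∘-cong ≈.refl project₁) (π-tuple (λ j → f (suc j)) i))

  ⟨⟩-ext : ∀ {X Y Z} {f g : Hom Z (X × Y)} → π₀ ∘ f ≈ π₀ ∘ g → π₁ ∘ f ≈ π₁ ∘ g → f ≈ g
  ⟨⟩-ext p q = ≈.trans (unique p q) (≈.sym (unique ≈.refl ≈.refl))

  π-ext : ∀ {n} {X : Vector Obj (suc n)} {Z} {f g : Hom Z (Π X)} →
          (∀ i → π {X = X} i ∘ f ≈ π i ∘ g) → f ≈ g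
  π-ext {zero}  eq = ≈.trans (≈.sym identityˡ) (≈.trans (eq zero) identityˡ)
  π-ext {suc n} eq = ⟨⟩-ext (eq zero)
    (π-ext (λ i → ≈.trans (≈.sym assoc) (≈.trans (eq (suc i)) assoc)))

  ⟨⟩-cong : ∀ {X Y Z} {f f′ : Hom Z X} {g g′ : Hom Z Y} →
            f ≈ f′ → g ≈ g′ → ⟨ f , g ⟩ ≈ ⟨ f′ , g′ ⟩
  ⟨⟩-cong p q = unique (≈.trans project₀ p) (≈.trans project₁ q)

  ⟨⟩-∘ : ∀ {X Y Z W} {f : Hom Z X} {g : Hom Z Y} {h : Hom W Z} →
         ⟨ f , g ⟩ ∘ h ≈ ⟨ f ∘ h , g ∘ h ⟩
  ⟨⟩-∘ = unique (≈.trans (≈.sym assoc) (∘-cong project₀ ≈.refl))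
                (≈.trans (≈.sym assoc) (∘-cong project₁ ≈.refl))

-- Over a commutative semiring the left semimodules are the semimodules.
record LeftAdditive {r ℓr o ℓ e} (R : CommutativeSemiring r ℓr) (𝒞 : Category o ℓ e)
                    : Set (r ⊔ ℓr ⊔ o ⊔ ℓ ⊔ e) where
  open Category 𝒞
  open CommutativeSemiring R using (Carrier; semiring)
  infixl 6 _+_
  infixr 7 _·_
  field
    _+_              : ∀ {X Y} → Hom X Y → Hom X Y → Hom X Y
    𝟎                : ∀ {X Y} → Hom X Y
    _·_              : ∀ {X Y} → Carrier → Hom X Y → Hom X Y
    isLeftSemimodule : ∀ {X Y} → IsLeftSemimodule semiring (_≈_ {X} {Y}) _+_ 𝟎 _·_

  hom : ∀ X Y → LeftSemimodule semiring ℓ e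
  hom X Y = record { isLeftSemimodule = isLeftSemimodule {X} {Y} }

  module hom {X} {Y} = LeftSemimodule (hom X Y)

  IsAdditiveMap : ∀ {X Y Z W} → (Hom X Y → Hom Z W) → Set (r ⊔ ℓ ⊔ e)
  IsAdditiveMap {X} {Y} {Z} {W} =
    LeftSemimoduleMorphisms.IsLeftSemimoduleHomomorphism
      (hom.rawLeftSemimodule {X} {Y}) (hom.rawLeftSemimodule {Z} {W})

  IsAdditive : ∀ {Y Z} → Hom Y Z → Set (r ⊔ o ⊔ ℓ ⊔ e)
  IsAdditive h = ∀ {X} → IsAdditiveMap {X} (h ∘_)

  field
    precomposition : ∀ {X Y Z} (f : Hom X Y) → IsAdditiveMap {Y} {Z} (_∘ f)

  sum : ∀ {X Y n} → Vector (Hom X Y) n → Hom X Y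
  sum {X} {Y} = RawMonoidDefinitions.sum (hom.+ᴹ-rawMonoid {X} {Y})

module _ {r ℓr} (R : CommutativeSemiring r ℓr) where

  record CartesianLeftAdditiveCategory o ℓ e : Set (r ⊔ ℓr ⊔ lsuc (o ⊔ ℓ ⊔ e)) where
    field
      category       : Category o ℓ e
      finiteProducts : FiniteProducts category
      leftAdditive   : LeftAdditive R category
    open Category category public
    open FiniteProducts finiteProducts public
    open LeftAdditive leftAdditive public
    field
      π-additive : ∀ {n} (X : Vector Obj (suc n)) i → IsAdditive (π {X = X} i)

  record Derivative {o ℓ e} (𝒞 : CartesianLeftAdditiveCategory o ℓ e)
                    : Set (r ⊔ o ⊔ ℓ ⊔ e) where
    open CartesianLeftAdditiveCategory 𝒞
    field
      D          : ∀ {X Y} → Hom X Y → Hom (X × X) Y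
      D-π        : ∀ {n} (X : Vector Obj (suc n)) i → D (π {X = X} i) ≈ π i ∘ π₁
      D-additive : ∀ {X Y} → IsAdditiveMap (D {X} {Y})
      D-idm      : ∀ {X} → D (idm {X}) ≈ π₁
      D-∘        : ∀ {X Y Z} (g : Hom Y Z) (f : Hom X Y) →
                   D (g ∘ f) ≈ D g ∘ ⟨ f ∘ π₀ , D f ⟩
      D-additive₁ : ∀ {X Y Z} (f : Hom X Y) (x : Hom Z X) →
                   IsAdditiveMap (λ (u : Hom Z X) → D f ∘ ⟨ x , u ⟩)
      D-D-linear : ∀ {X Y Z} (f : Hom X Y) (x u : Hom Z X) →
                   D (D f) ∘ ⟨ ⟨ x , 𝟎 ⟩ , ⟨ 𝟎 , u ⟩ ⟩ ≈ D f ∘ ⟨ x , u ⟩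
      D-D-swap   : ∀ {X Y Z} (f : Hom X Y) (x u v w : Hom Z X) →
                   D (D f) ∘ ⟨ ⟨ x , u ⟩ , ⟨ v , w ⟩ ⟩ ≈ D (D f) ∘ ⟨ ⟨ x , v ⟩ , ⟨ u , w ⟩ ⟩

  record CartesianDifferentialCategory o ℓ e : Set (r ⊔ ℓr ⊔ lsuc (o ⊔ ℓ ⊔ e)) where
    field
      cartesianLeftAdditiveCategory : CartesianLeftAdditiveCategory o ℓ e
      derivative                    : Derivative cartesianLeftAdditiveCategory
    open CartesianLeftAdditiveCategory cartesianLeftAdditiveCategory public
    open Derivative derivative public

  record IntegerInverses : Set (r ⊔ ℓr) where
    open CommutativeSemiring R
    open RawSemiringDefinitions rawSemiring using (_×_)
    field
      1/_         : ∀ n .{{_ : NonZero n}} → Carrier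
      1/-inverseˡ : ∀ n .{{_ : NonZero n}} → (1/ n) * (n × 1#) ≈ 1#

    _/_ : ℕ → ∀ n .{{_ : NonZero n}} → Carrier
    k / n = (k × 1#) * (1/ n)

    n/n : ∀ n .{{_ : NonZero n}} → n / n ≈ 1#
    n/n n = trans (*-comm _ _) (1/-inverseˡ n)

    k/n*j/k : ∀ j k n .{{_ : NonZero k}} .{{_ : NonZero n}} → (k / n) * (j / k) ≈ j / n
    k/n*j/k j k n = begin
      (k × 1# * 1/ n) * (j × 1# * 1/ k) ≈⟨ *-cong (*-comm _ _) (*-comm _ _) ⟩
      (1/ n * k × 1#) * (1/ k * j × 1#) ≈⟨ *-assoc _ _ _ ⟩
      1/ n * (k × 1# * (1/ k * j × 1#)) ≈⟨ *-congˡ (*-assoc _ _ _) ⟨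
      1/ n * ((k × 1# * 1/ k) * j × 1#) ≈⟨ *-congˡ (*-congʳ (n/n k)) ⟩
      1/ n * (1# * j × 1#)              ≈⟨ *-congˡ (*-identityˡ _) ⟩
      1/ n * j × 1#                     ≈⟨ *-comm _ _ ⟩
      j × 1# * 1/ n                     ∎
      where open SetoidReasoning setoid

module Taylor {r ℓr o ℓ e} (R : CommutativeSemiring r ℓr) (inverses : IntegerInverses R)
              (𝒞 : CartesianDifferentialCategory R o ℓ e) where
  open CartesianDifferentialCategory 𝒞
  open IntegerInverses inverses
  private module R = CommutativeSemiring R
  private open module Reasoning {X} {Y} = SetoidReasoning (homSetoid X Y)
  open RawSemiringDefinitions R.rawSemiring using (_^_)

  S : ℕ → Obj → Obj
  S n X = Π {n} (λ _ → X)

  p : ∀ {n X} (i : Fin (suc n)) → Hom (S n X) X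
  p {n} {X} i = π {n} {λ _ → X} i

  S-ext : ∀ n {X Z} {f g : Hom Z (S n X)} →
          (∀ (i : Fin (suc n)) → p i ∘ f ≈ p i ∘ g) → f ≈ g
  S-ext n {X} = π-ext {n} {λ _ → X}

  s : ∀ {n m X} → .(m ≤ n) → Hom (S n X) (S m X)
  s {m = m} m≤n = tuple {m} (λ j → p (inject≤ j (s≤s m≤n)))

  -- The map usually written νₙ₊₁, with entries 1/(n+1) π₁, …, (n+1)/(n+1) πₙ₊₁.
  ν : ∀ n {X} → Hom (S (suc n) X) (S n X × S n X)
  ν n = ⟨ tuple {n} (λ j → p (inject₁ j))
        , tuple {n} (λ j → (suc (toℕ j) / suc n) · p (suc j)) ⟩

  t : ∀ n {X Y} → Hom X Y → Hom (S n X) Y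
  t zero    f = f
  t (suc n) f = D (t n f) ∘ ν n

  T₁ : ∀ n {X Y} → Hom X Y → Hom (S n X) (S n Y)
  T₁ n f = tuple {n} (λ i → t (toℕ i) f ∘ s (toℕ≤pred[n] i))

  p-T₁ : ∀ n {X Y} (f : Hom X Y) i → p i ∘ T₁ n f ≈ t (toℕ i) f ∘ s (toℕ≤pred[n] i)
  p-T₁ n f = π-tuple {n} (λ i → t (toℕ i) f ∘ s (toℕ≤pred[n] i))

  p-s : ∀ {n m X} .(m≤n : m ≤ n) j → p {X = X} j ∘ s m≤n ≈ p (inject≤ j (s≤s m≤n))
  p-s {m = m} m≤n = π-tuple {m} (λ j → p (inject≤ j (s≤s m≤n)))

  p-cong : ∀ {n X} {i j : Fin (suc n)} → toℕ i ≡ toℕ j → p {X = X} i ≈ p j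
  p-cong eq = ≈.reflexive (≡.cong p (toℕ-injective eq))

  s-∘ : ∀ {l m n X} .(l≤m : l ≤ m) .(m≤n : m ≤ n) .(l≤n : l ≤ n) →
        s l≤m ∘ s m≤n ≈ s {X = X} l≤n
  s-∘ {l} l≤m m≤n l≤n = S-ext l λ j → begin
    p j ∘ (s l≤m ∘ s m≤n)                        ≈⟨ assoc ⟨
    (p j ∘ s l≤m) ∘ s m≤n                        ≈⟨ ∘-cong (p-s l≤m j) ≈.refl ⟩
    p (inject≤ j (s≤s l≤m)) ∘ s m≤n              ≈⟨ p-s m≤n _ ⟩
    p (inject≤ (inject≤ j (s≤s l≤m)) (s≤s m≤n))  ≈⟨ p-cong (≡.trans (toℕ-inject≤ _ (s≤s m≤n))
                                                     (≡.trans (toℕ-inject≤ j (s≤s l≤m))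
                                                       (≡.sym (toℕ-inject≤ j (s≤s l≤n))))) ⟩
    p (inject≤ j (s≤s l≤n))                      ≈⟨ p-s l≤n j ⟨
    p j ∘ s l≤n                                  ∎

  s-refl : ∀ {n X} .(n≤n : n ≤ n) → s n≤n ≈ idm {S n X}
  s-refl {n} n≤n = S-ext n λ j →
    ≈.trans (p-s n≤n j) (≈.trans (p-cong (toℕ-inject≤ j (s≤s n≤n))) (≈.sym identityʳ))

  t-index : ∀ {i j n X Y} (f : Hom X Y) → i ≡ j → .(i≤n : i ≤ n) .(j≤n : j ≤ n) →
            t i f ∘ s i≤n ≈ t j f ∘ s j≤n
  t-index f ≡.refl _ _ = ≈.refl

  T₁-s : ∀ {m n X Y} (f : Hom X Y) (m≤n : m ≤ n) → T₁ m f ∘ s m≤n ≈ s m≤n ∘ T₁ n f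
  T₁-s {m} {n} f m≤n = S-ext m λ j → begin
    p j ∘ (T₁ m f ∘ s m≤n)                       ≈⟨ assoc ⟨
    (p j ∘ T₁ m f) ∘ s m≤n                       ≈⟨ ∘-cong (p-T₁ m f j) ≈.refl ⟩
    (t (toℕ j) f ∘ s (toℕ≤pred[n] j)) ∘ s m≤n    ≈⟨ assoc ⟩
    t (toℕ j) f ∘ (s (toℕ≤pred[n] j) ∘ s m≤n)    ≈⟨ ∘-cong ≈.refl
                                                      (s-∘ (toℕ≤pred[n] j) m≤n
                                                        (≤-trans (toℕ≤pred[n] j) m≤n)) ⟩
    t (toℕ j) f ∘ s (≤-trans (toℕ≤pred[n] j) m≤n) ≈⟨ t-index f (≡.sym (toℕ-inject≤ j (s≤s m≤n)))
                                                      (≤-trans (toℕ≤pred[n] j) m≤n)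
                                                      (toℕ≤pred[n] (inject≤ j (s≤s m≤n))) ⟩
    t (toℕ (inject≤ j (s≤s m≤n))) f ∘ s (toℕ≤pred[n] (inject≤ j (s≤s m≤n)))
                                                 ≈⟨ p-T₁ n f (inject≤ j (s≤s m≤n)) ⟨
    p (inject≤ j (s≤s m≤n)) ∘ T₁ n f             ≈⟨ ∘-cong (p-s m≤n j) ≈.refl ⟨
    (p j ∘ s m≤n) ∘ T₁ n f                       ≈⟨ assoc ⟩
    p j ∘ (s m≤n ∘ T₁ n f)                       ∎

  D-cong : ∀ {X Y} {f g : Hom X Y} → f ≈ g → D f ≈ D g
  D-cong = LeftSemimoduleMorphisms.IsLeftSemimoduleHomomorphism.⟦⟧-cong D-additive

  ·-∘ : ∀ {X Y Z} a (g : Hom Y Z) (f : Hom X Y) → (a · g) ∘ f ≈ a · (g ∘ f)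
  ·-∘ a g f =
    LeftSemimoduleMorphisms.IsLeftSemimoduleHomomorphism.*ₗ-homo (precomposition f) a g

  p-· : ∀ {n X Z} (i : Fin (suc n)) a (h : Hom Z (S n X)) → p {n} i ∘ (a · h) ≈ a · (p i ∘ h)
  p-· {n} {X} i a h =
    LeftSemimoduleMorphisms.IsLeftSemimoduleHomomorphism.*ₗ-homo (π-additive {n} (λ _ → X) i) a h

  D-· : ∀ {X Y Z} (f : Hom X Y) (x : Hom Z X) a u →
        D f ∘ ⟨ x , a · u ⟩ ≈ a · (D f ∘ ⟨ x , u ⟩)
  D-· f x a u =
    LeftSemimoduleMorphisms.IsLeftSemimoduleHomomorphism.*ₗ-homo (D-additive₁ f x) a u

  p-D : ∀ {n X Y} i (h : Hom X (S n Y)) → p i ∘ D h ≈ D (p i ∘ h)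
  p-D {n} {Y = Y} i h = begin
    p i ∘ D h                        ≈⟨ ∘-cong ≈.refl project₁ ⟨
    p i ∘ (π₁ ∘ ⟨ h ∘ π₀ , D h ⟩)    ≈⟨ assoc ⟨
    (p i ∘ π₁) ∘ ⟨ h ∘ π₀ , D h ⟩    ≈⟨ ∘-cong (D-π {n} (λ _ → Y) i) ≈.refl ⟨
    D (p i) ∘ ⟨ h ∘ π₀ , D h ⟩       ≈⟨ D-∘ (p i) h ⟨
    D (p i ∘ h)                      ∎

  D-s : ∀ {m n X} .(m≤n : m ≤ n) → D (s {X = X} m≤n) ≈ s m≤n ∘ π₁
  D-s {m} {X = X} m≤n = S-ext m λ j → begin
    p j ∘ D (s m≤n)                    ≈⟨ p-D j (s m≤n) ⟩
    D (p j ∘ s m≤n)                    ≈⟨ D-cong (p-s m≤n j) ⟩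
    D (p (inject≤ j (s≤s m≤n)))        ≈⟨ D-π (λ _ → X) (inject≤ j (s≤s m≤n)) ⟩
    p (inject≤ j (s≤s m≤n)) ∘ π₁       ≈⟨ ∘-cong (p-s m≤n j) ≈.refl ⟨
    (p j ∘ s m≤n) ∘ π₁                 ≈⟨ assoc ⟩
    p j ∘ (s m≤n ∘ π₁)                 ∎

  π₀-ν : ∀ n {X} → π₀ ∘ ν n ≈ s {X = X} (n≤1+n n)
  π₀-ν n = ≈.trans project₀ (S-ext n λ j → ≈.trans (π-tuple {n} (λ j → p (inject₁ j)) j)
    (≈.trans (p-cong (≡.trans (toℕ-inject₁ j) (≡.sym (toℕ-inject≤ j (s≤s (n≤1+n n))))))
      (≈.sym (p-s (n≤1+n n) j))))

  p-π₁-ν : ∀ n {X} j → p {X = X} j ∘ (π₁ ∘ ν n) ≈ (suc (toℕ j) / suc n) · p (suc j)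
  p-π₁-ν n j = ≈.trans (∘-cong ≈.refl project₁)
    (π-tuple {n} (λ j → (suc (toℕ j) / suc n) · p (suc j)) j)

  s-π₁-ν : ∀ {m n X} .(m≤n : m ≤ n) .(1+m≤1+n : suc m ≤ suc n) →
           s m≤n ∘ (π₁ ∘ ν n) ≈ (suc m / suc n) · ((π₁ ∘ ν m) ∘ s {X = X} 1+m≤1+n)
  s-π₁-ν {m} {n} m≤n 1+m≤1+n = S-ext m λ j → begin
    p j ∘ (s m≤n ∘ (π₁ ∘ ν n))
      ≈⟨ assoc ⟨
    (p j ∘ s m≤n) ∘ (π₁ ∘ ν n)
      ≈⟨ ∘-cong (p-s m≤n j) ≈.refl ⟩
    p (inject≤ j (s≤s m≤n)) ∘ (π₁ ∘ ν n)
      ≈⟨ p-π₁-ν n (inject≤ j (s≤s m≤n)) ⟩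
    (suc (toℕ (inject≤ j (s≤s m≤n))) / suc n) · p (suc (inject≤ j (s≤s m≤n)))
      ≈⟨ hom.*ₗ-congʳ (R.reflexive (≡.cong (λ k → suc k / suc n) (toℕ-inject≤ j (s≤s m≤n)))) ⟩
    (suc (toℕ j) / suc n) · p (suc (inject≤ j (s≤s m≤n)))
      ≈⟨ hom.*ₗ-cong (k/n*j/k (suc (toℕ j)) (suc m) (suc n)) (p-s 1+m≤1+n (suc j)) ⟨
    ((suc m / suc n) R.* (suc (toℕ j) / suc m)) · (p (suc j) ∘ s 1+m≤1+n)
      ≈⟨ hom.*ₗ-assoc _ _ _ ⟩
    (suc m / suc n) · (suc (toℕ j) / suc m) · (p (suc j) ∘ s 1+m≤1+n)
      ≈⟨ hom.*ₗ-congˡ (·-∘ _ _ _) ⟨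
    (suc m / suc n) · (((suc (toℕ j) / suc m) · p (suc j)) ∘ s 1+m≤1+n)
      ≈⟨ hom.*ₗ-congˡ (∘-cong (p-π₁-ν m j) ≈.refl) ⟨
    (suc m / suc n) · ((p j ∘ (π₁ ∘ ν m)) ∘ s 1+m≤1+n)
      ≈⟨ hom.*ₗ-congˡ assoc ⟩
    (suc m / suc n) · (p j ∘ ((π₁ ∘ ν m) ∘ s 1+m≤1+n))
      ≈⟨ p-· {m} j _ _ ⟨
    p j ∘ ((suc m / suc n) · ((π₁ ∘ ν m) ∘ s 1+m≤1+n))
      ∎

  D-t-ν : ∀ {m n X Y} (f : Hom X Y) (m≤n : m ≤ n) →
          D (t m f ∘ s m≤n) ∘ ν n ≈ (suc m / suc n) · (t (suc m) f ∘ s (s≤s m≤n))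
  D-t-ν {m} {n} f m≤n = begin
    D (t m f ∘ s m≤n) ∘ ν n
      ≈⟨ ∘-cong (D-∘ _ _) ≈.refl ⟩
    (D (t m f) ∘ ⟨ s m≤n ∘ π₀ , D (s m≤n) ⟩) ∘ ν n
      ≈⟨ ≈.trans assoc (∘-cong ≈.refl (≈.trans ⟨⟩-∘ (⟨⟩-cong first second))) ⟩
    D (t m f) ∘ ⟨ π₀ ∘ (ν m ∘ s (s≤s m≤n)) , (suc m / suc n) · ((π₁ ∘ ν m) ∘ s (s≤s m≤n)) ⟩
      ≈⟨ D-· _ _ _ _ ⟩
    (suc m / suc n) · (D (t m f) ∘ ⟨ π₀ ∘ (ν m ∘ s (s≤s m≤n)) , (π₁ ∘ ν m) ∘ s (s≤s m≤n) ⟩)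
      ≈⟨ hom.*ₗ-congˡ (≈.trans assoc (∘-cong ≈.refl (unique ≈.refl (≈.sym assoc)))) ⟨
    (suc m / suc n) · (t (suc m) f ∘ s (s≤s m≤n))
      ∎
    where
      m≤1+n = ≤-trans m≤n (n≤1+n n)
      first : (s m≤n ∘ π₀) ∘ ν n ≈ π₀ ∘ (ν m ∘ s (s≤s m≤n))
      first = begin
        (s m≤n ∘ π₀) ∘ ν n              ≈⟨ assoc ⟩
        s m≤n ∘ (π₀ ∘ ν n)              ≈⟨ ∘-cong ≈.refl (π₀-ν n) ⟩
        s m≤n ∘ s (n≤1+n n)             ≈⟨ s-∘ m≤n (n≤1+n n) m≤1+n ⟩
        s m≤1+n                         ≈⟨ s-∘ (n≤1+n m) (s≤s m≤n) m≤1+n ⟨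
        s (n≤1+n m) ∘ s (s≤s m≤n)       ≈⟨ ∘-cong (π₀-ν m) ≈.refl ⟨
        (π₀ ∘ ν m) ∘ s (s≤s m≤n)        ≈⟨ assoc ⟩
        π₀ ∘ (ν m ∘ s (s≤s m≤n))        ∎
      second : D (s m≤n) ∘ ν n ≈ (suc m / suc n) · ((π₁ ∘ ν m) ∘ s (s≤s m≤n))
      second = ≈.trans (∘-cong (D-s m≤n) ≈.refl) (≈.trans assoc (s-π₁-ν m≤n (s≤s m≤n)))

  ν-natural : ∀ n {X Y} (f : Hom X Y) →
              ⟨ T₁ n f ∘ π₀ , D (T₁ n f) ⟩ ∘ ν n ≈ ν n ∘ T₁ (suc n) f
  ν-natural n f = ≈.trans ⟨⟩-∘ (≈.sym (unique first (S-ext n second)))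
    where
      first : π₀ ∘ (ν n ∘ T₁ (suc n) f) ≈ (T₁ n f ∘ π₀) ∘ ν n
      first = begin
        π₀ ∘ (ν n ∘ T₁ (suc n) f)       ≈⟨ assoc ⟨
        (π₀ ∘ ν n) ∘ T₁ (suc n) f       ≈⟨ ∘-cong (π₀-ν n) ≈.refl ⟩
        s (n≤1+n n) ∘ T₁ (suc n) f      ≈⟨ T₁-s f (n≤1+n n) ⟨
        T₁ n f ∘ s (n≤1+n n)            ≈⟨ ∘-cong ≈.refl (π₀-ν n) ⟨
        T₁ n f ∘ (π₀ ∘ ν n)             ≈⟨ assoc ⟨
        (T₁ n f ∘ π₀) ∘ ν n             ∎
      second : ∀ j → p j ∘ (π₁ ∘ (ν n ∘ T₁ (suc n) f)) ≈ p j ∘ (D (T₁ n f) ∘ ν n)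
      second j = begin
        p j ∘ (π₁ ∘ (ν n ∘ T₁ (suc n) f))
          ≈⟨ ≈.trans (∘-cong ≈.refl (≈.sym assoc)) (≈.sym assoc) ⟩
        (p j ∘ (π₁ ∘ ν n)) ∘ T₁ (suc n) f
          ≈⟨ ∘-cong (p-π₁-ν n j) ≈.refl ⟩
        ((suc (toℕ j) / suc n) · p (suc j)) ∘ T₁ (suc n) f
          ≈⟨ ·-∘ _ _ _ ⟩
        (suc (toℕ j) / suc n) · (p (suc j) ∘ T₁ (suc n) f)
          ≈⟨ hom.*ₗ-congˡ (p-T₁ (suc n) f (suc j)) ⟩
        (suc (toℕ j) / suc n) · (t (suc (toℕ j)) f ∘ s (s≤s (toℕ≤pred[n] j)))
          ≈⟨ D-t-ν f (toℕ≤pred[n] j) ⟨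
        D (t (toℕ j) f ∘ s (toℕ≤pred[n] j)) ∘ ν n
          ≈⟨ ∘-cong (D-cong (p-T₁ n f j)) ≈.refl ⟨
        D (p j ∘ T₁ n f) ∘ ν n
          ≈⟨ ∘-cong (p-D j _) ≈.refl ⟨
        (p j ∘ D (T₁ n f)) ∘ ν n
          ≈⟨ assoc ⟩
        p j ∘ (D (T₁ n f) ∘ ν n)
          ∎

  t-∘ : ∀ n {X Y Z} (g : Hom Y Z) (f : Hom X Y) → t n (g ∘ f) ≈ t n g ∘ T₁ n f
  t-∘ zero    g f = ∘-cong ≈.refl (≈.sym (≈.trans (∘-cong ≈.refl (s-refl {0} ≤-refl)) identityʳ))
  t-∘ (suc n) g f = begin
    D (t n (g ∘ f)) ∘ ν n                                 ≈⟨ ∘-cong (D-cong (t-∘ n g f)) ≈.refl ⟩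
    D (t n g ∘ T₁ n f) ∘ ν n                              ≈⟨ ∘-cong (D-∘ _ _) ≈.refl ⟩
    (D (t n g) ∘ ⟨ T₁ n f ∘ π₀ , D (T₁ n f) ⟩) ∘ ν n      ≈⟨ assoc ⟩
    D (t n g) ∘ (⟨ T₁ n f ∘ π₀ , D (T₁ n f) ⟩ ∘ ν n)      ≈⟨ ∘-cong ≈.refl (ν-natural n f) ⟩
    D (t n g) ∘ (ν n ∘ T₁ (suc n) f)                      ≈⟨ assoc ⟨
    (D (t n g) ∘ ν n) ∘ T₁ (suc n) f                      ∎

  t-idm : ∀ n {X} → t n (idm {X}) ≈ p (fromℕ n)
  t-idm zero    = ≈.refl
  t-idm (suc n) {X} = begin
    D (t n idm) ∘ ν n                                ≈⟨ ∘-cong (D-cong (t-idm n)) ≈.refl ⟩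
    D (p (fromℕ n)) ∘ ν n                            ≈⟨ ∘-cong (D-π (λ _ → X) (fromℕ n)) ≈.refl ⟩
    (p (fromℕ n) ∘ π₁) ∘ ν n                         ≈⟨ assoc ⟩
    p (fromℕ n) ∘ (π₁ ∘ ν n)                         ≈⟨ p-π₁-ν n (fromℕ n) ⟩
    (suc (toℕ (fromℕ n)) / suc n) · p (suc (fromℕ n)) ≈⟨ hom.*ₗ-congʳ (R.trans
                                                           (R.reflexive (≡.cong (λ k → suc k / suc n) (toℕ-fromℕ n)))
                                                           (n/n (suc n))) ⟩
    R.1# · p (suc (fromℕ n))                         ≈⟨ hom.*ₗ-identityˡ _ ⟩
    p (suc (fromℕ n))                                ∎

  t-cong : ∀ n {X Y} {f g : Hom X Y} → f ≈ g → t n f ≈ t n g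
  t-cong zero    eq = eq
  t-cong (suc n) eq = ∘-cong (D-cong (t-cong n eq)) ≈.refl

  T : ℕ → Functor category category
  T n = record
    { F₀   = S n
    ; F₁   = T₁ n
    ; cong = λ {_} {_} {f} {g} eq → S-ext n λ i →
        ≈.trans (p-T₁ n f i) (≈.trans (∘-cong (t-cong (toℕ i) eq) ≈.refl) (≈.sym (p-T₁ n g i)))
    ; idm  = S-ext n λ i → begin
        p i ∘ T₁ n idm                                         ≈⟨ p-T₁ n idm i ⟩
        t (toℕ i) idm ∘ s (toℕ≤pred[n] i)                      ≈⟨ ∘-cong (t-idm (toℕ i)) ≈.refl ⟩
        p (fromℕ (toℕ i)) ∘ s (toℕ≤pred[n] i)                  ≈⟨ p-s (toℕ≤pred[n] i) (fromℕ (toℕ i)) ⟩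
        p (inject≤ (fromℕ (toℕ i)) (s≤s (toℕ≤pred[n] i)))      ≈⟨ p-cong (≡.trans
                                                                    (toℕ-inject≤ _ (s≤s (toℕ≤pred[n] i)))
                                                                    (toℕ-fromℕ (toℕ i))) ⟩
        p i                                                    ≈⟨ identityʳ ⟨
        p i ∘ idm                                              ∎
    ; homo = λ g f → S-ext n λ i → begin
        p i ∘ T₁ n (g ∘ f)                                     ≈⟨ p-T₁ n (g ∘ f) i ⟩
        t (toℕ i) (g ∘ f) ∘ s (toℕ≤pred[n] i)                  ≈⟨ ∘-cong (t-∘ (toℕ i) g f) ≈.refl ⟩
        (t (toℕ i) g ∘ T₁ (toℕ i) f) ∘ s (toℕ≤pred[n] i)       ≈⟨ assoc ⟩
        t (toℕ i) g ∘ (T₁ (toℕ i) f ∘ s (toℕ≤pred[n] i))       ≈⟨ ∘-cong ≈.refl (T₁-s f (toℕ≤pred[n] i)) ⟩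
        t (toℕ i) g ∘ (s (toℕ≤pred[n] i) ∘ T₁ n f)             ≈⟨ assoc ⟨
        (t (toℕ i) g ∘ s (toℕ≤pred[n] i)) ∘ T₁ n f             ≈⟨ ∘-cong (p-T₁ n g i) ≈.refl ⟨
        (p i ∘ T₁ n g) ∘ T₁ n f                                ≈⟨ assoc ⟩
        p i ∘ (T₁ n g ∘ T₁ n f)                                ∎
    }

  ι : ∀ n X → Hom X (S n X)
  ι n X = tuple {n} component
    where
      component : Fin (suc n) → Hom X X
      component zero    = idm
      component (suc _) = 𝟎

  -- The summation index i runs over 0, …, k, and opposite i = k ∸ i.
  θ : ∀ n X → Hom (S n (S n X)) (S n X)
  θ n X = tuple {n} λ k → sum λ (i : Fin (suc (toℕ k))) →
    p (inject≤ i (toℕ<n k)) ∘ p (inject≤ (opposite i) (toℕ<n k))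

  c : ∀ n m X → Hom (S n (S m X)) (S m (S n X))
  c n m X = tuple {m} λ j → tuple {n} λ i → p j ∘ p i

  scale : ∀ n → R.Carrier → ∀ X → Hom (S n X) (S n X)
  scale n a X = tuple {n} λ k → (a ^ toℕ k) · p k

-- A morphism into S n X is a sequence x₀, …, xₙ of generalized elements of X, and on such
-- sequences t (n + 1) f is D (t n f) applied to (x₀, …, xₙ) in direction
-- (1/(n+1) x₁, …, (n+1)/(n+1) xₙ₊₁).  Each of the four naturality squares thus becomes an
-- identity between values of iterated t's, proved by induction on the order.  In the inductive
-- step the induction hypothesis, taken at the generic sequence of projections, is
-- differentiated; projections are linear (D h = h ∘ π₁), so the chain rule is harmless.
-- For c this is the symmetry tⱼ tᵢ f = tᵢ tⱼ f up to transposition, resting on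
-- D-D-swap; for θ it is tₖ f (y₀, …, yₖ) = Σ_{i+j=k} tⱼ tᵢ f (x) with yₗ = Σ_{i+j=l} xⱼᵢ,
-- where the weights (i + j)/(k + 1) split the derivative into an inner and an outer one.

module Submission where

open import Algebra.Bundles using (CommutativeSemiring)
open import Algebra.Module.Morphism.Structures using (module LeftSemimoduleMorphisms)
import Algebra.Definitions.RawSemiring as RawSemiringDefinitions
import Algebra.Properties.CommutativeMonoid.Sum as CommutativeMonoidSum
import Algebra.Properties.Monoid.Mult as MonoidMult
open import Data.Fin.Base using (Fin; zero; suc; toℕ; fromℕ; inject≤; opposite)
open import Data.Fin.Properties
  using (toℕ<n; toℕ≤pred[n]; toℕ-inject≤; toℕ-fromℕ; toℕ-fromℕ<; opposite-prop)
open import Data.Nat.Base as ℕ using (ℕ; zero; suc; _≤_; s≤s; _∸_)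
open import Data.Nat.DivMod using (_mod_; m≤n⇒m%n≡m)
import Data.Nat.Properties as ℕ
open import Data.Product.Base using (_×_; _,_)
open import Data.Vec.Functional using (_∷_; [])
open import Function.Base using (flip)
open import Relation.Binary.PropositionalEquality.Core as ≡ using (_≡_)
import Relation.Binary.Reasoning.Setoid as SetoidReasoning
open import Defs

module Naturality {r ℓr o ℓ e} (R : CommutativeSemiring r ℓr) (inverses : IntegerInverses R)
                  (𝒞 : CartesianDifferentialCategory R o ℓ e) where
  open CartesianDifferentialCategory 𝒞 renaming (_×_ to _⊗_)
  open IntegerInverses inverses
  open Taylor R inverses 𝒞
  open RawSemiringDefinitions (CommutativeSemiring.rawSemiring R) using (_^_)
  private
    module R = CommutativeSemiring R
    open module Reasoning {X} {Y} = SetoidReasoning (homSetoid X Y)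
    module Additive {X Y Z W} {F : Hom X Y → Hom Z W} (F-additive : IsAdditiveMap F) =
      LeftSemimoduleMorphisms.IsLeftSemimoduleHomomorphism F-additive
    module Sum {X Y} = CommutativeMonoidSum (hom.+ᴹ-commutativeMonoid {X} {Y})

  -- Congruence of composition

  ∘-congˡ : ∀ {X Y Z} {g : Hom Y Z} {f f′ : Hom X Y} → f ≈ f′ → g ∘ f ≈ g ∘ f′
  ∘-congˡ = ∘-cong ≈.refl

  ∘-congʳ : ∀ {X Y Z} {g g′ : Hom Y Z} {f : Hom X Y} → g ≈ g′ → g ∘ f ≈ g′ ∘ f
  ∘-congʳ eq = ∘-cong eq ≈.refl

  ∘-identity : ∀ {X Y} {g : Hom X Y} {h : Hom X X} → h ≈ idm → g ∘ h ≈ g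
  ∘-identity eq = ≈.trans (∘-congˡ eq) identityʳ

  -- Linear morphisms

  -- Linearity in the sense of differential categories: the derivative at every point is `h` itself.
  -- It implies additivity, since `h ∘ u` is then `D h ∘ ⟨ 𝟎 , u ⟩`.
  Linear : ∀ {X Y} → Hom X Y → Set e
  Linear h = D h ≈ h ∘ π₁

  linear-cong : ∀ {X Y} {g h : Hom X Y} → g ≈ h → Linear g → Linear h
  linear-cong eq lin = ≈.trans (D-cong (≈.sym eq)) (≈.trans lin (∘-congʳ eq))

  D-∘-linearˡ : ∀ {X Y Z} {h : Hom Y Z} (g : Hom X Y) → Linear h → D (h ∘ g) ≈ h ∘ D g
  D-∘-linearˡ {h = h} g lin = begin
    D (h ∘ g)                       ≈⟨ D-∘ h g ⟩
    D h ∘ ⟨ g ∘ π₀ , D g ⟩          ≈⟨ ∘-congʳ lin ⟩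
    (h ∘ π₁) ∘ ⟨ g ∘ π₀ , D g ⟩     ≈⟨ assoc ⟩
    h ∘ (π₁ ∘ ⟨ g ∘ π₀ , D g ⟩)     ≈⟨ ∘-congˡ project₁ ⟩
    h ∘ D g                         ∎

  D-∘-linearʳ : ∀ {W X Y Z} (g : Hom Y Z) {h : Hom X Y} {u v : Hom W X} → Linear h →
                D (g ∘ h) ∘ ⟨ u , v ⟩ ≈ D g ∘ ⟨ h ∘ u , h ∘ v ⟩
  D-∘-linearʳ g {h} {u} {v} lin = begin
    D (g ∘ h) ∘ ⟨ u , v ⟩                      ≈⟨ ∘-congʳ (D-∘ g h) ⟩
    (D g ∘ ⟨ h ∘ π₀ , D h ⟩) ∘ ⟨ u , v ⟩       ≈⟨ assoc ⟩
    D g ∘ (⟨ h ∘ π₀ , D h ⟩ ∘ ⟨ u , v ⟩)       ≈⟨ ∘-congˡ ⟨⟩-∘ ⟩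
    D g ∘ ⟨ (h ∘ π₀) ∘ ⟨ u , v ⟩ , D h ∘ ⟨ u , v ⟩ ⟩
      ≈⟨ ∘-congˡ (⟨⟩-cong (≈.trans assoc (∘-congˡ project₀))
                          (≈.trans (∘-congʳ lin) (≈.trans assoc (∘-congˡ project₁)))) ⟩
    D g ∘ ⟨ h ∘ u , h ∘ v ⟩                    ∎

  linear-idm : ∀ {X} → Linear (idm {X})
  linear-idm = ≈.trans D-idm (≈.sym identityˡ)

  linear-∘ : ∀ {X Y Z} {h : Hom Y Z} {g : Hom X Y} → Linear h → Linear g → Linear (h ∘ g)
  linear-∘ {g = g} h-lin g-lin =
    ≈.trans (D-∘-linearˡ g h-lin) (≈.trans (∘-congˡ g-lin) (≈.sym assoc))

  linear-π₀ : ∀ {X Y} → Linear (π₀ {X} {Y})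
  -- The binary product is `Π` of a two-entry vector on the nose, so `D-π` applies to it.
  linear-π₀ {X} {Y} = D-π (X ∷ Y ∷ []) zero

  linear-π₁ : ∀ {X Y} → Linear (π₁ {X} {Y})
  -- The last projection of that vector unfolds to `idm ∘ π₁`.
  linear-π₁ {X} {Y} = linear-cong identityˡ (D-π (X ∷ Y ∷ []) (suc zero))

  linear-p : ∀ {n X} (i : Fin (suc n)) → Linear (p {X = X} i)
  linear-p {X = X} = D-π (λ _ → X)

  linear-⟨⟩ : ∀ {X Y Z} {f : Hom Z X} {g : Hom Z Y} → Linear f → Linear g → Linear ⟨ f , g ⟩
  linear-⟨⟩ f-lin g-lin = ⟨⟩-ext
    (≈.trans (≈.sym (D-∘-linearˡ _ linear-π₀))
             (≈.trans (linear-cong (≈.sym project₀) f-lin) assoc))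
    (≈.trans (≈.sym (D-∘-linearˡ _ linear-π₁))
             (≈.trans (linear-cong (≈.sym project₁) g-lin) assoc))

  linear-𝟎 : ∀ {X Y} → Linear (𝟎 {X} {Y})
  linear-𝟎 = ≈.trans (Additive.0ᴹ-homo D-additive)
                     (≈.sym (Additive.0ᴹ-homo (precomposition π₁)))

  linear-+ : ∀ {X Y} {g h : Hom X Y} → Linear g → Linear h → Linear (g + h)
  linear-+ g-lin h-lin = ≈.trans (Additive.+ᴹ-homo D-additive _ _)
    (≈.trans (hom.+ᴹ-cong g-lin h-lin) (≈.sym (Additive.+ᴹ-homo (precomposition π₁) _ _)))

  linear-· : ∀ {X Y} a {h : Hom X Y} → Linear h → Linear (a · h)
  linear-· a lin = ≈.trans (Additive.*ₗ-homo D-additive _ _)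
    (≈.trans (hom.*ₗ-congˡ lin) (≈.sym (·-∘ _ _ _)))

  linear-sum : ∀ {X Y n} (h : Fin n → Hom X Y) → (∀ i → Linear (h i)) → Linear (sum h)
  linear-sum {n = zero}  h lin = linear-𝟎
  linear-sum {n = suc n} h lin =
    linear-+ (lin zero) (linear-sum (λ i → h (suc i)) (λ i → lin (suc i)))

  -- Postcomposition with `h` is `D h` at a fixed base point, here `𝟎`, and `D h` is homogeneous in
  -- its direction.
  linear⇒∘-· : ∀ {X Y Z} {h : Hom Y Z} → Linear h → ∀ a (u : Hom X Y) → h ∘ (a · u) ≈ a · (h ∘ u)
  linear⇒∘-· {h = h} lin a u =
    ≈.trans (≈.sym (D-apply (a · u))) (≈.trans (D-· h 𝟎 a u) (hom.*ₗ-congˡ (D-apply u)))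
    where
      D-apply : ∀ v → D h ∘ ⟨ 𝟎 , v ⟩ ≈ h ∘ v
      D-apply v = ≈.trans (∘-congʳ lin) (≈.trans assoc (∘-congˡ project₁))

  -- This is how an induction hypothesis gets differentiated: the equation is known at generic
  -- elements `h` and `h′`, and their linearity lets the chain rule carry the base point `u` and the
  -- direction `v` through unchanged in form.
  D-congruence : ∀ {W X Y Y′ Z} {g : Hom Y Z} {h : Hom X Y} {g′ : Hom Y′ Z} {h′ : Hom X Y′}
                 {u v : Hom W X} → Linear h → Linear h′ → g ∘ h ≈ g′ ∘ h′ →
                 D g ∘ ⟨ h ∘ u , h ∘ v ⟩ ≈ D g′ ∘ ⟨ h′ ∘ u , h′ ∘ v ⟩
  D-congruence lin lin′ eq = ≈.trans (≈.sym (D-∘-linearʳ _ lin))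
    (≈.trans (∘-congʳ (D-cong eq)) (D-∘-linearʳ _ lin′))

  ·-⟨⟩ : ∀ {X Y Z} a (f : Hom Z X) (g : Hom Z Y) → a · ⟨ f , g ⟩ ≈ ⟨ a · f , a · g ⟩
  ·-⟨⟩ a f g = unique
    (≈.trans (linear⇒∘-· linear-π₀ a _) (hom.*ₗ-congˡ project₀))
    (≈.trans (linear⇒∘-· linear-π₁ a _) (hom.*ₗ-congˡ project₁))

  -- Morphisms into S n X as sequences of generalized elements of X

  -- Opaque so that unification can recover x from seq n x.
  opaque
    seq : ∀ n {Z X} → (ℕ → Hom Z X) → Hom Z (S n X)
    seq n x = tuple {n} λ i → x (toℕ i)

    p-seq : ∀ {n Z X} (x : ℕ → Hom Z X) (i : Fin (suc n)) → p i ∘ seq n x ≈ x (toℕ i)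
    p-seq {n} x = π-tuple {n} (λ i → x (toℕ i))

    -- Unary products are the object itself, so this holds by unfolding, which is available only
    -- inside the opaque block.
    seq-zero : ∀ {Z X} (x : ℕ → Hom Z X) → seq 0 x ≈ x 0
    seq-zero x = ≈.refl

  seq-unique : ∀ n {Z X} {h : Hom Z (S n X)} (x : ℕ → Hom Z X) →
               (∀ (i : Fin (suc n)) → p i ∘ h ≈ x (toℕ i)) → h ≈ seq n x
  seq-unique n x eq = S-ext n λ i → ≈.trans (eq i) (≈.sym (p-seq x i))

  seq-cong-≤ : ∀ n {Z X} {x y : ℕ → Hom Z X} → (∀ i → i ≤ n → x i ≈ y i) → seq n x ≈ seq n y
  seq-cong-≤ n {x = x} {y} eq = seq-unique n y λ i →
    ≈.trans (p-seq x i) (eq (toℕ i) (toℕ≤pred[n] i))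

  seq-cong : ∀ n {Z X} {x y : ℕ → Hom Z X} → (∀ i → x i ≈ y i) → seq n x ≈ seq n y
  seq-cong n eq = seq-cong-≤ n λ i _ → eq i

  seq-∘ : ∀ n {W Z X} (x : ℕ → Hom Z X) (h : Hom W Z) → seq n x ∘ h ≈ seq n λ i → x i ∘ h
  seq-∘ n x h = seq-unique n (λ i → x i ∘ h) λ i → ≈.trans (≈.sym assoc) (∘-congʳ (p-seq x i))

  ·-seq : ∀ n {Z X} a (x : ℕ → Hom Z X) → a · seq n x ≈ seq n λ i → a · x i
  ·-seq n a x = seq-unique n (λ i → a · x i) λ i →
    ≈.trans (p-· {n} i a _) (hom.*ₗ-congˡ (p-seq x i))

  s-seq : ∀ {m n Z X} .(m≤n : m ≤ n) (x : ℕ → Hom Z X) → s m≤n ∘ seq n x ≈ seq m x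
  s-seq {m} {n} m≤n x = seq-unique m x λ i → begin
    p i ∘ (s m≤n ∘ seq n x)              ≈⟨ assoc ⟨
    (p i ∘ s m≤n) ∘ seq n x              ≈⟨ ∘-congʳ (p-s m≤n i) ⟩
    p (inject≤ i (s≤s m≤n)) ∘ seq n x    ≈⟨ p-seq x (inject≤ i (s≤s m≤n)) ⟩
    x (toℕ (inject≤ i (s≤s m≤n)))        ≈⟨ ≈.reflexive (≡.cong x (toℕ-inject≤ i (s≤s m≤n))) ⟩
    x (toℕ i)                            ∎

  linear-seq : ∀ n {Z X} {x : ℕ → Hom Z X} → (∀ i → Linear (x i)) → Linear (seq n x)
  linear-seq n {x = x} lin = S-ext n λ i → ≈.trans (p-D {n} i (seq n x))
    (≈.trans (linear-cong (≈.sym (p-seq x i)) (lin (toℕ i))) assoc)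

  -- Out-of-range indices wrap around; they are never used.
  coord : ∀ n {X} → ℕ → Hom (S n X) X
  coord n i = p (i mod suc n)

  coord-seq : ∀ n {Z X} (x : ℕ → Hom Z X) {i} → i ≤ n → coord n i ∘ seq n x ≈ x i
  coord-seq n x {i} i≤n = ≈.trans (p-seq x (i mod suc n))
    (≈.reflexive (≡.cong x (≡.trans (toℕ-fromℕ< _) (m≤n⇒m%n≡m i≤n))))

  linear-coord : ∀ n {X} i → Linear (coord n {X} i)
  linear-coord n i = linear-p (i mod suc n)

  -- The coordinates form the generic sequence: what is shown on it is shown for morphisms out of
  -- `S n X`.
  seq-coord : ∀ n {X} → seq n (coord n {X}) ≈ idm
  seq-coord n = ≈.sym (seq-unique n (coord n) λ i → ≈.trans identityʳ
    (p-cong (≡.sym (≡.trans (toℕ-fromℕ< _) (m≤n⇒m%n≡m (toℕ≤pred[n] i))))))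

  -- Values of `t` and `T₁` on sequences

  -- With `x` read as the coefficients of a polynomial, this is its formal derivative divided by
  -- `suc n`: the direction that `ν n` supplies.
  ∂ : ∀ n {Z X} → (ℕ → Hom Z X) → ℕ → Hom Z X
  ∂ n x i = (suc i / suc n) · x (suc i)

  ν-seq : ∀ n {Z X} (x : ℕ → Hom Z X) → ν n ∘ seq (suc n) x ≈ ⟨ seq n x , seq n (∂ n x) ⟩
  ν-seq n x = unique
    (≈.trans (≈.sym assoc) (≈.trans (∘-congʳ (π₀-ν n)) (s-seq (ℕ.n≤1+n n) x)))
    (seq-unique n (∂ n x) λ i → begin
      p i ∘ (π₁ ∘ (ν n ∘ seq (suc n) x))   ≈⟨ ∘-congˡ assoc ⟨
      p i ∘ ((π₁ ∘ ν n) ∘ seq (suc n) x)   ≈⟨ assoc ⟨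
      (p i ∘ (π₁ ∘ ν n)) ∘ seq (suc n) x   ≈⟨ ∘-congʳ (p-π₁-ν n i) ⟩
      ((suc (toℕ i) / suc n) · p (suc i)) ∘ seq (suc n) x ≈⟨ ·-∘ _ _ _ ⟩
      (suc (toℕ i) / suc n) · (p (suc i) ∘ seq (suc n) x) ≈⟨ hom.*ₗ-congˡ (p-seq x (suc i)) ⟩
      ∂ n x (toℕ i)                        ∎)

  t-suc-seq : ∀ n {Z X Y} (f : Hom X Y) (x : ℕ → Hom Z X) →
              t (suc n) f ∘ seq (suc n) x ≈ D (t n f) ∘ ⟨ seq n x , seq n (∂ n x) ⟩
  t-suc-seq n f x = ≈.trans assoc (∘-congˡ (ν-seq n x))

  T₁-seq : ∀ n {Z X Y} (f : Hom X Y) (x : ℕ → Hom Z X) →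
           T₁ n f ∘ seq n x ≈ seq n λ i → t i f ∘ seq i x
  T₁-seq n f x = seq-unique n (λ i → t i f ∘ seq i x) λ i → begin
    p i ∘ (T₁ n f ∘ seq n x)                       ≈⟨ assoc ⟨
    (p i ∘ T₁ n f) ∘ seq n x                       ≈⟨ ∘-congʳ (p-T₁ n f i) ⟩
    (t (toℕ i) f ∘ s (toℕ≤pred[n] i)) ∘ seq n x    ≈⟨ assoc ⟩
    t (toℕ i) f ∘ (s (toℕ≤pred[n] i) ∘ seq n x)    ≈⟨ ∘-congˡ (s-seq (toℕ≤pred[n] i) x) ⟩
    t (toℕ i) f ∘ seq (toℕ i) x                    ∎

  t-∘-linearˡ : ∀ n {X Y Z} {h : Hom Y Z} (g : Hom X Y) → Linear h → t n (h ∘ g) ≈ h ∘ t n g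
  t-∘-linearˡ zero    g lin = ≈.refl
  t-∘-linearˡ (suc n) {h = h} g lin = begin
    D (t n (h ∘ g)) ∘ ν n     ≈⟨ ∘-congʳ (D-cong (t-∘-linearˡ n g lin)) ⟩
    D (h ∘ t n g) ∘ ν n       ≈⟨ ∘-congʳ (D-∘-linearˡ (t n g) lin) ⟩
    (h ∘ D (t n g)) ∘ ν n     ≈⟨ assoc ⟩
    h ∘ (D (t n g) ∘ ν n)     ∎

  -- Writing `h` as `h ∘ idm` reduces this to `t-idm`, so only the last entry survives.
  t-linear-seq : ∀ n {X Y Z} {h : Hom X Y} → Linear h → (x : ℕ → Hom Z X) →
                 t n h ∘ seq n x ≈ h ∘ x n
  t-linear-seq n {h = h} lin x = begin
    t n h ∘ seq n x                   ≈⟨ ∘-congʳ (t-cong n identityʳ) ⟨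
    t n (h ∘ idm) ∘ seq n x           ≈⟨ ∘-congʳ (t-∘-linearˡ n idm lin) ⟩
    (h ∘ t n idm) ∘ seq n x           ≈⟨ assoc ⟩
    h ∘ (t n idm ∘ seq n x)           ≈⟨ ∘-congˡ (∘-congʳ (t-idm n)) ⟩
    h ∘ (p (fromℕ n) ∘ seq n x)       ≈⟨ ∘-congˡ (p-seq x (fromℕ n)) ⟩
    h ∘ x (toℕ (fromℕ n))             ≈⟨ ∘-congˡ (≈.reflexive (≡.cong x (toℕ-fromℕ n))) ⟩
    h ∘ x n                           ∎

  t-∘-linearʳ : ∀ n {W X Y Z} (g : Hom Y Z) {h : Hom X Y} → Linear h → (x : ℕ → Hom W X) →
                t n (g ∘ h) ∘ seq n x ≈ t n g ∘ seq n λ i → h ∘ x i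
  t-∘-linearʳ n g {h} lin x = begin
    t n (g ∘ h) ∘ seq n x             ≈⟨ ∘-congʳ (t-∘ n g h) ⟩
    (t n g ∘ T₁ n h) ∘ seq n x        ≈⟨ assoc ⟩
    t n g ∘ (T₁ n h ∘ seq n x)        ≈⟨ ∘-congˡ (T₁-seq n h x) ⟩
    t n g ∘ seq n (λ i → t i h ∘ seq i x)
      ≈⟨ ∘-congˡ (seq-cong n (λ i → t-linear-seq i lin x)) ⟩
    t n g ∘ seq n (λ i → h ∘ x i)     ∎

  ·-comm : ∀ {X Y} a b (u : Hom X Y) → a · b · u ≈ b · a · u
  ·-comm a b u = ≈.trans (≈.sym (hom.*ₗ-assoc a b u))
    (≈.trans (hom.*ₗ-congʳ (R.*-comm a b)) (hom.*ₗ-assoc b a u))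

  -- Evaluated at the generic sequence, `ν n` becomes a pair of sequences of scaled coordinates,
  -- whose linearity is visible.
  linear-ν : ∀ n {X} → Linear (ν n {X})
  linear-ν n = linear-cong
    (≈.trans (≈.sym (ν-seq n (coord (suc n))))
      (≈.trans (∘-congˡ (seq-coord (suc n))) identityʳ))
    (linear-⟨⟩ (linear-seq n (linear-coord (suc n)))
      (linear-seq n (λ i → linear-· _ (linear-coord (suc n) (suc i)))))

  -- (i + 1)/(k + 1) = (n + 1)/(k + 1) ⋅ (i + 1)/(n + 1), and D is homogeneous in its direction.
  D-t-∂ : ∀ n k {Z X Y} (f : Hom X Y) (x : ℕ → Hom Z X) →
          D (t n f) ∘ ⟨ seq n x , seq n (∂ k x) ⟩
          ≈ (suc n / suc k) · (t (suc n) f ∘ seq (suc n) x)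
  D-t-∂ n k f x = begin
    D (t n f) ∘ ⟨ seq n x , seq n (∂ k x) ⟩
      ≈⟨ ∘-congˡ (⟨⟩-cong ≈.refl rescale) ⟩
    D (t n f) ∘ ⟨ seq n x , (suc n / suc k) · seq n (∂ n x) ⟩
      ≈⟨ D-· (t n f) _ _ _ ⟩
    (suc n / suc k) · (D (t n f) ∘ ⟨ seq n x , seq n (∂ n x) ⟩)
      ≈⟨ hom.*ₗ-congˡ (t-suc-seq n f x) ⟨
    (suc n / suc k) · (t (suc n) f ∘ seq (suc n) x)
      ∎
    where
      rescale : seq n (∂ k x) ≈ (suc n / suc k) · seq n (∂ n x)
      rescale = ≈.trans
        (seq-cong n (λ i → ≈.trans
          (hom.*ₗ-congʳ (R.sym (k/n*j/k (suc i) (suc n) (suc k)))) (hom.*ₗ-assoc _ _ _)))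
        (≈.sym (·-seq n _ (∂ n x)))

  -- Weighted homogeneity

  -- Entry `i` has weight `i`. Since `∂` shifts the indices by one, a single factor `a` comes out of
  -- the direction by `D-·`; the remaining `a ^ n` comes from the differentiated induction
  -- hypothesis.
  t-homogeneous : ∀ n a {Z X Y} (f : Hom X Y) (x : ℕ → Hom Z X) →
                  t n f ∘ seq n (λ i → (a ^ i) · x i) ≈ (a ^ n) · (t n f ∘ seq n x)
  t-homogeneous zero    a f x =
    ≈.trans
      (∘-congˡ (≈.trans (seq-zero _) (≈.trans (hom.*ₗ-identityˡ (x 0)) (≈.sym (seq-zero x)))))
      (≈.sym (hom.*ₗ-identityˡ (f ∘ seq 0 x)))
  t-homogeneous (suc n) a f x = begin
    t (suc n) f ∘ seq (suc n) (λ i → (a ^ i) · x i)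
      ≈⟨ t-suc-seq n f _ ⟩
    D (t n f) ∘ ⟨ scaled x , seq n (∂ n (λ i → (a ^ i) · x i)) ⟩
      ≈⟨ ∘-congˡ (⟨⟩-cong ≈.refl extract) ⟩
    D (t n f) ∘ ⟨ scaled x , a · scaled (∂ n x) ⟩
      ≈⟨ D-· (t n f) _ _ _ ⟩
    a · (D (t n f) ∘ ⟨ scaled x , scaled (∂ n x) ⟩)
      ≈⟨ hom.*ₗ-congˡ (∘-congˡ (⟨⟩-cong (scaled-coord x) (scaled-coord (∂ n x)))) ⟨
    a · (D (t n f) ∘ ⟨ scaled (coord n) ∘ seq n x , scaled (coord n) ∘ seq n (∂ n x) ⟩)
      -- The induction hypothesis at `coord n`: the unscaled generic sequence is `idm`, so its
      -- right-hand side is just `(a ^ n) · t n f`.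
      ≈⟨ hom.*ₗ-congˡ (D-congruence
           (linear-seq n (λ i → linear-· (a ^ i) (linear-coord n i)))
           linear-idm
           (≈.trans (t-homogeneous n a f (coord n))
             (≈.trans (hom.*ₗ-congˡ (∘-congˡ (seq-coord n))) (≈.sym (·-∘ _ _ _))))) ⟩
    a · (D ((a ^ n) · t n f) ∘ ⟨ idm ∘ seq n x , idm ∘ seq n (∂ n x) ⟩)
      ≈⟨ hom.*ₗ-congˡ (∘-cong (Additive.*ₗ-homo D-additive _ _) (⟨⟩-cong identityˡ identityˡ)) ⟩
    a · (((a ^ n) · D (t n f)) ∘ ⟨ seq n x , seq n (∂ n x) ⟩)
      ≈⟨ hom.*ₗ-congˡ (≈.trans (·-∘ _ _ _) (hom.*ₗ-congˡ (≈.sym (t-suc-seq n f x)))) ⟩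
    a · (a ^ n) · (t (suc n) f ∘ seq (suc n) x)
      ≈⟨ hom.*ₗ-assoc a (a ^ n) _ ⟨
    (a ^ suc n) · (t (suc n) f ∘ seq (suc n) x)
      ∎
    where
      scaled : ∀ {W V} → (ℕ → Hom W V) → Hom W (S n V)
      scaled y = seq n (λ i → (a ^ i) · y i)

      scaled-coord : ∀ {W V} (y : ℕ → Hom W V) → scaled (coord n) ∘ seq n y ≈ scaled y
      scaled-coord y = ≈.trans (seq-∘ n _ _) (seq-cong-≤ n (λ i i≤n →
        ≈.trans (·-∘ _ _ _) (hom.*ₗ-congˡ (coord-seq n y i≤n))))

      extract : seq n (∂ n (λ i → (a ^ i) · x i)) ≈ a · scaled (∂ n x)
      extract = ≈.trans
        (seq-cong n (λ i → ≈.trans (hom.*ₗ-congˡ (hom.*ₗ-assoc a (a ^ i) _))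
          (≈.trans (·-comm _ a _) (hom.*ₗ-congˡ (·-comm _ (a ^ i) _)))))
        (≈.sym (·-seq n a _))

  -- Interchange of `t` and `D`

  -- The differentiated induction hypothesis has base point made of `x` and `y` and direction made
  -- of `∂ n x` and `∂ n y`. `D-D-swap` exchanges `y` with `∂ n x`, which regroups the data into the
  -- values of `ν n` at `x` and at `y`.
  t-D : ∀ n {Z X Y} (g : Hom X Y) (x y : ℕ → Hom Z X) →
        t n (D g) ∘ seq n (λ i → ⟨ x i , y i ⟩) ≈ D (t n g) ∘ ⟨ seq n x , seq n y ⟩
  t-D zero    g x y = ∘-congˡ
    (≈.trans (seq-zero _) (≈.sym (⟨⟩-cong (seq-zero x) (seq-zero y))))
  t-D (suc n) g x y = begin
    t (suc n) (D g) ∘ seq (suc n) (λ i → ⟨ x i , y i ⟩)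
      ≈⟨ t-suc-seq n (D g) _ ⟩
    D (t n (D g)) ∘ ⟨ zipped x y , seq n (∂ n (λ i → ⟨ x i , y i ⟩)) ⟩
      ≈⟨ ∘-congˡ (⟨⟩-cong (zipped-coord x y)
           (≈.trans (zipped-coord (∂ n x) (∂ n y)) (seq-cong n (λ i → ≈.sym (·-⟨⟩ _ _ _))))) ⟨
    D (t n (D g)) ∘ ⟨ zipped x₀ y₀ ∘ ⟨ seq n x , seq n y ⟩
                    , zipped x₀ y₀ ∘ ⟨ seq n (∂ n x) , seq n (∂ n y) ⟩ ⟩
      ≈⟨ D-congruence (linear-seq n (λ i → linear-⟨⟩ (linear-x₀ i) (linear-y₀ i)))
           (linear-⟨⟩ (linear-seq n linear-x₀) (linear-seq n linear-y₀))
           (t-D n g x₀ y₀) ⟩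
    D (D (t n g)) ∘ ⟨ ⟨ seq n x₀ , seq n y₀ ⟩ ∘ ⟨ seq n x , seq n y ⟩
                    , ⟨ seq n x₀ , seq n y₀ ⟩ ∘ ⟨ seq n (∂ n x) , seq n (∂ n y) ⟩ ⟩
      ≈⟨ ∘-congˡ (⟨⟩-cong (pair-coord x y) (pair-coord (∂ n x) (∂ n y))) ⟩
    D (D (t n g)) ∘ ⟨ ⟨ seq n x , seq n y ⟩ , ⟨ seq n (∂ n x) , seq n (∂ n y) ⟩ ⟩
      ≈⟨ D-D-swap (t n g) _ _ _ _ ⟩
    D (D (t n g)) ∘ ⟨ ⟨ seq n x , seq n (∂ n x) ⟩ , ⟨ seq n y , seq n (∂ n y) ⟩ ⟩
      ≈⟨ ∘-congˡ (⟨⟩-cong (ν-seq n x) (ν-seq n y)) ⟨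
    D (D (t n g)) ∘ ⟨ ν n ∘ seq (suc n) x , ν n ∘ seq (suc n) y ⟩
      ≈⟨ D-∘-linearʳ (D (t n g)) (linear-ν n) ⟨
    D (t (suc n) g) ∘ ⟨ seq (suc n) x , seq (suc n) y ⟩
      ∎
    where
      -- The generic pair of sequences, at which the induction hypothesis is taken.
      x₀ y₀ : ∀ {V} → ℕ → Hom (S n V ⊗ S n V) V
      x₀ i = coord n i ∘ π₀
      y₀ i = coord n i ∘ π₁

      linear-x₀ : ∀ {V} i → Linear (x₀ {V} i)
      linear-x₀ i = linear-∘ (linear-coord n i) linear-π₀

      linear-y₀ : ∀ {V} i → Linear (y₀ {V} i)
      linear-y₀ i = linear-∘ (linear-coord n i) linear-π₁

      zipped : ∀ {W V} → (ℕ → Hom W V) → (ℕ → Hom W V) → Hom W (S n (V ⊗ V))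
      zipped u v = seq n (λ i → ⟨ u i , v i ⟩)

      x₀-∘ : ∀ {W V} (u v : ℕ → Hom W V) i → i ≤ n → x₀ i ∘ ⟨ seq n u , seq n v ⟩ ≈ u i
      x₀-∘ u v i i≤n = ≈.trans assoc (≈.trans (∘-congˡ project₀) (coord-seq n u i≤n))

      y₀-∘ : ∀ {W V} (u v : ℕ → Hom W V) i → i ≤ n → y₀ i ∘ ⟨ seq n u , seq n v ⟩ ≈ v i
      y₀-∘ u v i i≤n = ≈.trans assoc (≈.trans (∘-congˡ project₁) (coord-seq n v i≤n))

      zipped-coord : ∀ {W V} (u v : ℕ → Hom W V) →
                     zipped x₀ y₀ ∘ ⟨ seq n u , seq n v ⟩ ≈ zipped u v
      zipped-coord u v = ≈.trans (seq-∘ n _ _) (seq-cong-≤ n (λ i i≤n →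
        ≈.trans ⟨⟩-∘ (⟨⟩-cong (x₀-∘ u v i i≤n) (y₀-∘ u v i i≤n))))

      pair-coord : ∀ {W V} (u v : ℕ → Hom W V) →
                   ⟨ seq n x₀ , seq n y₀ ⟩ ∘ ⟨ seq n u , seq n v ⟩ ≈ ⟨ seq n u , seq n v ⟩
      pair-coord u v = ≈.trans ⟨⟩-∘ (⟨⟩-cong
        (≈.trans (seq-∘ n _ _) (seq-cong-≤ n (x₀-∘ u v)))
        (≈.trans (seq-∘ n _ _) (seq-cong-≤ n (y₀-∘ u v))))

  -- Matrices of generalized elements and the symmetry of iterated `t`

  mat : ∀ n m {Z X} → (ℕ → ℕ → Hom Z X) → Hom Z (S n (S m X))
  mat n m x = seq n λ j → seq m (x j)

  mat-cong-≤ : ∀ n m {Z X} {x y : ℕ → ℕ → Hom Z X} →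
               (∀ j i → j ≤ n → i ≤ m → x j i ≈ y j i) → mat n m x ≈ mat n m y
  mat-cong-≤ n m eq = seq-cong-≤ n λ j j≤n → seq-cong-≤ m λ i → eq j i j≤n

  mat-cong : ∀ n m {Z X} {x y : ℕ → ℕ → Hom Z X} →
             (∀ j i → x j i ≈ y j i) → mat n m x ≈ mat n m y
  mat-cong n m eq = mat-cong-≤ n m λ j i _ _ → eq j i

  mat-∘ : ∀ n m {W Z X} (x : ℕ → ℕ → Hom Z X) (h : Hom W Z) →
          mat n m x ∘ h ≈ mat n m λ j i → x j i ∘ h
  mat-∘ n m x h = ≈.trans (seq-∘ n _ h) (seq-cong n (λ j → seq-∘ m (x j) h))

  -- The generic matrix. As in `mat`, the outer index comes first, although its projection stands on
  -- the right of the composite.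
  entry : ∀ n m {X} → ℕ → ℕ → Hom (S n (S m X)) X
  entry n m j i = coord m i ∘ coord n j

  linear-entry : ∀ n m {X} j i → Linear (entry n m {X} j i)
  linear-entry n m j i = linear-∘ (linear-coord m i) (linear-coord n j)

  linear-mat-entry : ∀ j i n m {X} → Linear (mat j i (entry n m {X}))
  linear-mat-entry j i n m = linear-seq j λ b → linear-seq i λ a → linear-entry n m b a

  entry-mat : ∀ n m {Z X} (x : ℕ → ℕ → Hom Z X) {j i} → j ≤ n → i ≤ m →
              entry n m j i ∘ mat n m x ≈ x j i
  entry-mat n m x {j} j≤n i≤m = ≈.trans assoc
    (≈.trans (∘-congˡ (coord-seq n _ j≤n)) (coord-seq m (x j) i≤m))

  -- `mat j i (entry n m)` truncates to the leading block, so that terms of different sizes can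
  -- share one ambient matrix.
  mat-entry : ∀ n m {Z X} (x : ℕ → ℕ → Hom Z X) {j i} → j ≤ n → i ≤ m →
              mat j i (entry n m) ∘ mat n m x ≈ mat j i x
  mat-entry n m x {j} {i} j≤n i≤m = ≈.trans (mat-∘ j i _ _)
    (mat-cong-≤ j i (λ b a b≤j a≤i → entry-mat n m x (ℕ.≤-trans b≤j j≤n) (ℕ.≤-trans a≤i i≤m)))

  mat-entry-idm : ∀ n m {X} → mat n m (entry n m {X}) ≈ idm
  mat-entry-idm n m = begin
    mat n m (entry n m)                             ≈⟨ seq-cong n (λ j → seq-∘ m (coord m) (coord n j)) ⟨
    seq n (λ j → seq m (coord m) ∘ coord n j)       ≈⟨ seq-cong n (λ j → ∘-congʳ (seq-coord m)) ⟩
    seq n (λ j → idm ∘ coord n j)                   ≈⟨ seq-cong n (λ j → identityˡ) ⟩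
    seq n (coord n)                                 ≈⟨ seq-coord n ⟩
    idm                                             ∎

  -- The hypothesis covers all matrices, hence the generic one; that matrix and its transpose are
  -- linear, so the equation can be differentiated.
  D-mat-swap : ∀ n m {Z X Y} {f : Hom (S n (S m X)) Y} {g : Hom (S m (S n X)) Y} →
               (∀ {W} (x : ℕ → ℕ → Hom W X) → f ∘ mat n m x ≈ g ∘ mat m n (flip x)) →
               (x y : ℕ → ℕ → Hom Z X) →
               D f ∘ ⟨ mat n m x , mat n m y ⟩ ≈ D g ∘ ⟨ mat m n (flip x) , mat m n (flip y) ⟩
  D-mat-swap n m {f = f} {g} eq x y = begin
    D f ∘ ⟨ mat n m x , mat n m y ⟩
      ≈⟨ ∘-congˡ (⟨⟩-cong (mat-entry n m x ℕ.≤-refl ℕ.≤-refl) (mat-entry n m y ℕ.≤-refl ℕ.≤-refl)) ⟨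
    D f ∘ ⟨ mat n m (entry n m) ∘ mat n m x , mat n m (entry n m) ∘ mat n m y ⟩
      ≈⟨ D-congruence (linear-mat-entry n m n m)
           (linear-seq m (λ i → linear-seq n (λ j → linear-entry n m j i))) (eq (entry n m)) ⟩
    D g ∘ ⟨ mat m n (flip (entry n m)) ∘ mat n m x , mat m n (flip (entry n m)) ∘ mat n m y ⟩
      ≈⟨ ∘-congˡ (⟨⟩-cong (transposed x) (transposed y)) ⟩
    D g ∘ ⟨ mat m n (flip x) , mat m n (flip y) ⟩
      ∎
    where
      transposed : ∀ z → mat m n (flip (entry n m)) ∘ mat n m z ≈ mat m n (flip z)
      transposed z = ≈.trans (mat-∘ m n _ _)
        (mat-cong-≤ m n (λ i j i≤m j≤n → entry-mat n m z j≤n i≤m))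

  -- Induction on the inner order `i`: `t-D` pulls the `D` of `t (suc i) f` outside `t j`, and the
  -- differentiated induction hypothesis then yields the expression that defines
  -- `t (suc i) (t j f)`.
  t-swap : ∀ j i {Z X Y} (f : Hom X Y) (x : ℕ → ℕ → Hom Z X) →
           t j (t i f) ∘ mat j i x ≈ t i (t j f) ∘ mat i j (flip x)
  t-swap j zero    f x = ∘-congˡ
    (≈.trans (seq-cong j (λ b → seq-zero (x b))) (≈.sym (seq-zero _)))
  t-swap j (suc i) f x = begin
    t j (D (t i f) ∘ ν i) ∘ mat j (suc i) x
      ≈⟨ t-∘-linearʳ j (D (t i f)) (linear-ν i) (λ b → seq (suc i) (x b)) ⟩
    t j (D (t i f)) ∘ seq j (λ b → ν i ∘ seq (suc i) (x b))
      ≈⟨ ∘-congˡ (seq-cong j (λ b → ν-seq i (x b))) ⟩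
    t j (D (t i f)) ∘ seq j (λ b → ⟨ seq i (x b) , seq i (∂ i (x b)) ⟩)
      ≈⟨ t-D j (t i f) _ _ ⟩
    D (t j (t i f)) ∘ ⟨ mat j i x , mat j i (λ b → ∂ i (x b)) ⟩
      ≈⟨ D-mat-swap j i (t-swap j i f) x (λ b → ∂ i (x b)) ⟩
    D (t i (t j f)) ∘ ⟨ mat i j (flip x) , mat i j (λ a b → ∂ i (x b) a) ⟩
      ≈⟨ ∘-congˡ (⟨⟩-cong ≈.refl (seq-cong i (λ a → ≈.sym (·-seq j _ (flip x (suc a)))))) ⟩
    D (t i (t j f)) ∘ ⟨ mat i j (flip x) , seq i (∂ i (λ a → seq j (flip x a))) ⟩
      ≈⟨ t-suc-seq i (t j f) _ ⟨
    t (suc i) (t j f) ∘ mat (suc i) j (flip x)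
      ∎

  -- Sums over the pairs i + j = k

  -- The subtraction never truncates, as `toℕ i ≤ k`. For a matrix `x`, `conv (flip x)` lists the
  -- coefficients obtained by equating the two variables of the polynomial with coefficients
  -- `x j i`.
  conv : ∀ {X Y} → (ℕ → ℕ → Hom X Y) → ℕ → Hom X Y
  conv F k = sum λ (i : Fin (suc k)) → F (toℕ i) (k ∸ toℕ i)

  conv-cong-≡ : ∀ {X Y} {F G : ℕ → ℕ → Hom X Y} k →
                (∀ i j → i ℕ.+ j ≡ k → F i j ≈ G i j) → conv F k ≈ conv G k
  conv-cong-≡ k eq = Sum.sum-cong-≋ {n = suc k} λ i →
    eq (toℕ i) (k ∸ toℕ i) (ℕ.m+[n∸m]≡n (toℕ≤pred[n] i))

  conv-cong-≤ : ∀ {X Y} {F G : ℕ → ℕ → Hom X Y} k →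
                (∀ i j → i ≤ k → j ≤ k → F i j ≈ G i j) → conv F k ≈ conv G k
  conv-cong-≤ {F = F} {G} k eq = conv-cong-≡ {F = F} {G} k λ where
    i j ≡.refl → eq i j (ℕ.m≤m+n i j) (ℕ.m≤n+m j i)

  conv-cong : ∀ {X Y} {F G : ℕ → ℕ → Hom X Y} k → (∀ i j → F i j ≈ G i j) → conv F k ≈ conv G k
  conv-cong {F = F} {G} k eq = conv-cong-≡ {F = F} {G} k λ i j _ → eq i j

  sum-homo : ∀ {X Y Z W} {φ : Hom X Y → Hom Z W} → IsAdditiveMap φ →
             ∀ {n} (v : Fin n → Hom X Y) → φ (sum v) ≈ sum λ i → φ (v i)
  sum-homo φ-additive {zero}  v = Additive.0ᴹ-homo φ-additive
  sum-homo φ-additive {suc n} v = ≈.trans (Additive.+ᴹ-homo φ-additive _ _)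
    (hom.+ᴹ-congˡ (sum-homo φ-additive λ i → v (suc i)))

  conv-homo : ∀ {X Y Z W} {φ : Hom X Y → Hom Z W} → IsAdditiveMap φ →
              ∀ (F : ℕ → ℕ → Hom X Y) k → φ (conv F k) ≈ conv (λ i j → φ (F i j)) k
  conv-homo φ-additive F k =
    sum-homo φ-additive λ (i : Fin (suc k)) → F (toℕ i) (k ∸ toℕ i)

  ·-additive : ∀ {X Y} a → IsAdditiveMap {X} {Y} (a ·_)
  ·-additive a = record
    { +ᴹ-isMonoidHomomorphism = record
      { isMagmaHomomorphism = record
        { isRelHomomorphism = record { cong = hom.*ₗ-congˡ }
        ; homo = hom.*ₗ-distribˡ a }
      ; ε-homo = hom.*ₗ-zeroʳ a }
    ; *ₗ-homo = λ b u → ·-comm a b u }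

  conv-+ : ∀ {X Y} (F G : ℕ → ℕ → Hom X Y) k →
           conv (λ i j → F i j + G i j) k ≈ conv F k + conv G k
  conv-+ F G k = Sum.∑-distrib-+ {n = suc k}
    (λ i → F (toℕ i) (k ∸ toℕ i)) (λ i → G (toℕ i) (k ∸ toℕ i))

  conv-shiftˡ : ∀ {X Y} (F : ℕ → ℕ → Hom X Y) k → (∀ j → F 0 j ≈ 𝟎) →
                conv F (suc k) ≈ conv (λ i j → F (suc i) j) k
  conv-shiftˡ F k zeroˡ = ≈.trans (hom.+ᴹ-congʳ (zeroˡ (suc k))) (hom.+ᴹ-identityˡ _)

  -- Sums unfold from the front while the vanishing term `F (suc k) 0` stands last, hence the
  -- induction on `k` with `F` varying.
  conv-shiftʳ : ∀ {X Y} (F : ℕ → ℕ → Hom X Y) k → (∀ i → F i 0 ≈ 𝟎) →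
                conv F (suc k) ≈ conv (λ i j → F i (suc j)) k
  conv-shiftʳ F zero    zeroʳ =
    hom.+ᴹ-congˡ (≈.trans (hom.+ᴹ-identityʳ _) (zeroʳ 1))
  conv-shiftʳ F (suc k) zeroʳ =
    hom.+ᴹ-congˡ (conv-shiftʳ (λ i j → F (suc i) j) k (λ i → zeroʳ (suc i)))

  0/n·-zero : ∀ n {X Y} (u : Hom X Y) → (0 / suc n) · u ≈ 𝟎
  0/n·-zero n u = ≈.trans (hom.*ₗ-congʳ (R.zeroˡ _)) (hom.*ₗ-zeroˡ u)

  /-homo-+ : ∀ i j n → (i ℕ.+ j) / suc n R.≈ i / suc n R.+ j / suc n
  /-homo-+ i j n = R.trans
    (R.*-congʳ (MonoidMult.×-homo-+ R.+-monoid R.1# i j))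
    (R.distribʳ _ _ _)

  -- Splits the weight (m + 1)/(k + 1) = i/(k + 1) + j/(k + 1) on the terms with i + j = m + 1.
  conv-Leibniz : ∀ {X Y} (F : ℕ → ℕ → Hom X Y) m k →
                 (suc m / suc k) · conv F (suc m)
                 ≈ conv (λ i j → (suc j / suc k) · F i (suc j)) m
                   + conv (λ i j → (suc i / suc k) · F (suc i) j) m
  conv-Leibniz F m k = begin
    (suc m / suc k) · conv F (suc m)
      ≈⟨ conv-homo (·-additive _) F (suc m) ⟩
    conv (λ i j → (suc m / suc k) · F i j) (suc m)
      ≈⟨ conv-cong-≡ (suc m) (λ i j i+j≡1+m → ≈.trans
           (hom.*ₗ-congʳ (R.trans (R.reflexive (≡.cong (λ l → l / suc k)
             (≡.trans (≡.sym i+j≡1+m) (ℕ.+-comm i j)))) (/-homo-+ j i k)))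
           (hom.*ₗ-distribʳ (F i j) _ _)) ⟩
    conv (λ i j → (j / suc k) · F i j + (i / suc k) · F i j) (suc m)
      ≈⟨ conv-+ (λ i j → (j / suc k) · F i j) (λ i j → (i / suc k) · F i j) (suc m) ⟩
    conv (λ i j → (j / suc k) · F i j) (suc m) + conv (λ i j → (i / suc k) · F i j) (suc m)
      -- The term of weight `0 / suc k` drops out: the last one (`j = 0`) in the first sum, the
      -- first one (`i = 0`) in the second.
      ≈⟨ hom.+ᴹ-cong
           (conv-shiftʳ (λ i j → (j / suc k) · F i j) m (λ i → 0/n·-zero k _))
           (conv-shiftˡ (λ i j → (i / suc k) · F i j) m (λ j → 0/n·-zero k _)) ⟩
    conv (λ i j → (suc j / suc k) · F i (suc j)) m + conv (λ i j → (suc i / suc k) · F (suc i) j) m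
      ∎

  linear-conv : ∀ {X Y} (F : ℕ → ℕ → Hom X Y) k → (∀ i j → Linear (F i j)) → Linear (conv F k)
  linear-conv F k lin = linear-sum {n = suc k} _ λ i → lin (toℕ i) (k ∸ toℕ i)

  seq-+ : ∀ n {Z X} (x y : ℕ → Hom Z X) → seq n x + seq n y ≈ seq n λ i → x i + y i
  seq-+ n {X = X} x y = seq-unique n _ λ i →
    ≈.trans (Additive.+ᴹ-homo (π-additive {n} (λ _ → X) i) _ _)
            (hom.+ᴹ-cong (p-seq x i) (p-seq y i))

  -- Iterated `t` on sums along diagonals

  -- The identity is differentiated at the generic `k` by `k` matrix, which contains every block
  -- that occurs because `i` and `j` are at most `k`; `D` and precomposition are additive and pass
  -- through the sum.
  D-conv : ∀ k {X Y} {f : Hom (S k X) Y} (F : ∀ i j → Hom (S j (S i X)) Y) →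
           (∀ {Z} (x : ℕ → ℕ → Hom Z X) →
             f ∘ seq k (conv (flip x)) ≈ conv (λ i j → F i j ∘ mat j i x) k) →
           ∀ {Z} (x y : ℕ → ℕ → Hom Z X) →
           D f ∘ ⟨ seq k (conv (flip x)) , seq k (conv (flip y)) ⟩
           ≈ conv (λ i j → D (F i j) ∘ ⟨ mat j i x , mat j i y ⟩) k
  D-conv k {f = f} F eq x y = begin
    D f ∘ ⟨ seq k (conv (flip x)) , seq k (conv (flip y)) ⟩
      ≈⟨ ∘-congˡ (⟨⟩-cong (seq-conv x) (seq-conv y)) ⟨
    D f ∘ ⟨ seq k (conv (flip E)) ∘ mat k k x , seq k (conv (flip E)) ∘ mat k k y ⟩
      ≈⟨ D-∘-linearʳ f (linear-seq k (λ m →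
           linear-conv (flip E) m (λ i j → linear-entry k k j i))) ⟨
    D (f ∘ seq k (conv (flip E))) ∘ ⟨ mat k k x , mat k k y ⟩
      ≈⟨ ∘-congʳ (D-cong (eq E)) ⟩
    D (conv (λ i j → F i j ∘ mat j i E) k) ∘ ⟨ mat k k x , mat k k y ⟩
      ≈⟨ ∘-congʳ (conv-homo D-additive (λ i j → F i j ∘ mat j i E) k) ⟩
    conv (λ i j → D (F i j ∘ mat j i E)) k ∘ ⟨ mat k k x , mat k k y ⟩
      ≈⟨ conv-homo (precomposition _) (λ i j → D (F i j ∘ mat j i E)) k ⟩
    conv (λ i j → D (F i j ∘ mat j i E) ∘ ⟨ mat k k x , mat k k y ⟩) k
      ≈⟨ conv-cong-≤ k (λ i j i≤k j≤k → ≈.trans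
           (D-∘-linearʳ (F i j) (linear-mat-entry j i k k))
           (∘-congˡ (⟨⟩-cong (mat-entry k k x j≤k i≤k) (mat-entry k k y j≤k i≤k)))) ⟩
    conv (λ i j → D (F i j) ∘ ⟨ mat j i x , mat j i y ⟩) k
      ∎
    where
      E : ∀ {V} → ℕ → ℕ → Hom (S k (S k V)) V
      E = entry k k

      seq-conv : ∀ {W V} (z : ℕ → ℕ → Hom W V) →
                 seq k (conv (flip E)) ∘ mat k k z ≈ seq k (conv (flip z))
      seq-conv z = ≈.trans (seq-∘ k _ _) (seq-cong-≤ k (λ m m≤k → ≈.trans
        (conv-homo (precomposition _) (flip E) m)
        (conv-cong-≤ m (λ i j i≤m j≤m →
          entry-mat k k z (ℕ.≤-trans j≤m m≤k) (ℕ.≤-trans i≤m m≤k)))))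

  -- `conv-Leibniz` splits the direction into a part `∂ₒx` differentiating along the outer index and
  -- a part `∂ᵢx` along the inner one. Additivity of `D` in its direction separates them, the
  -- induction hypothesis is differentiated for each, and `conv-Leibniz` read backwards on the
  -- values `τ` reassembles the two sums.
  t-conv : ∀ k {Z X Y} (f : Hom X Y) (x : ℕ → ℕ → Hom Z X) →
           t k f ∘ seq k (conv (flip x)) ≈ conv (λ i j → t j (t i f) ∘ mat j i x) k
  t-conv zero f x = ≈.trans
    (∘-congˡ (≈.trans (seq-zero _) (≈.trans (hom.+ᴹ-identityʳ _)
      (≈.sym (≈.trans (seq-zero _) (seq-zero (x 0)))))))
    (≈.sym (hom.+ᴹ-identityʳ _))
  t-conv (suc k) f x = begin
    t (suc k) f ∘ seq (suc k) (conv (flip x))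
      ≈⟨ t-suc-seq k f _ ⟩
    D (t k f) ∘ ⟨ seq k (conv (flip x)) , seq k (∂ k (conv (flip x))) ⟩
      ≈⟨ ∘-congˡ (⟨⟩-cong ≈.refl (≈.trans
           (seq-cong k (λ m → conv-Leibniz (flip x) m k)) (≈.sym (seq-+ k _ _)))) ⟩
    D (t k f) ∘ ⟨ seq k (conv (flip x)) , seq k (conv (flip ∂ₒx)) + seq k (conv (flip ∂ᵢx)) ⟩
      ≈⟨ Additive.+ᴹ-homo (D-additive₁ (t k f) _) _ _ ⟩
    D (t k f) ∘ ⟨ seq k (conv (flip x)) , seq k (conv (flip ∂ₒx)) ⟩
    + D (t k f) ∘ ⟨ seq k (conv (flip x)) , seq k (conv (flip ∂ᵢx)) ⟩
      ≈⟨ hom.+ᴹ-cong (D-conv k (λ i j → t j (t i f)) (t-conv k f) x ∂ₒx)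
                     (D-conv k (λ i j → t j (t i f)) (t-conv k f) x ∂ᵢx) ⟩
    conv (λ i j → D (t j (t i f)) ∘ ⟨ mat j i x , mat j i ∂ₒx ⟩) k
    + conv (λ i j → D (t j (t i f)) ∘ ⟨ mat j i x , mat j i ∂ᵢx ⟩) k
      ≈⟨ hom.+ᴹ-cong (conv-cong k (λ i j → outer j i x)) (conv-cong k inner) ⟩
    conv (λ i j → (suc j / suc k) · τ i (suc j)) k + conv (λ i j → (suc i / suc k) · τ (suc i) j) k
      -- Taking `m = k` makes the total weight `suc k / suc k`, which is one.
      ≈⟨ conv-Leibniz τ k k ⟨
    (suc k / suc k) · conv τ (suc k)
      ≈⟨ hom.*ₗ-congʳ (n/n (suc k)) ⟩
    R.1# · conv τ (suc k)
      ≈⟨ hom.*ₗ-identityˡ _ ⟩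
    conv τ (suc k)
      ∎
    where
      τ : ℕ → ℕ → Hom _ _
      τ i j = t j (t i f) ∘ mat j i x

      ∂ₒx ∂ᵢx : ℕ → ℕ → Hom _ _
      ∂ₒx j i = ∂ k (λ b → x b i) j
      ∂ᵢx j i = ∂ k (x j) i

      -- General in `y`, since `inner` needs it at the transpose `flip x`.
      outer : ∀ j i (y : ℕ → ℕ → Hom _ _) →
              D (t j (t i f)) ∘ ⟨ mat j i y , mat j i (λ b a → ∂ k (λ b′ → y b′ a) b) ⟩
              ≈ (suc j / suc k) · (t (suc j) (t i f) ∘ mat (suc j) i y)
      outer j i y = ≈.trans
        (∘-congˡ (⟨⟩-cong ≈.refl (seq-cong j (λ b → ≈.sym (·-seq i _ (y (suc b)))))))
        (D-t-∂ j k (t i f) (λ b → seq i (y b)))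

      -- Transposing by `t-swap` turns the inner direction into an outer one.
      inner : ∀ i j → D (t j (t i f)) ∘ ⟨ mat j i x , mat j i ∂ᵢx ⟩ ≈ (suc i / suc k) · τ (suc i) j
      inner i j = begin
        D (t j (t i f)) ∘ ⟨ mat j i x , mat j i ∂ᵢx ⟩
          ≈⟨ D-mat-swap j i (t-swap j i f) x ∂ᵢx ⟩
        D (t i (t j f)) ∘ ⟨ mat i j (flip x) , mat i j (flip ∂ᵢx) ⟩
          ≈⟨ outer i j (flip x) ⟩
        (suc i / suc k) · (t (suc i) (t j f) ∘ mat (suc i) j (flip x))
          ≈⟨ hom.*ₗ-congˡ (t-swap j (suc i) f x) ⟨
        (suc i / suc k) · τ (suc i) j
          ∎

  -- The naturality squares

  -- The projection `p i` and the truncation `s` are both linear, so they move through `t j`; this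
  -- reduces the squares for `θ` and `c` to identities between iterated `t`.
  T₁T₁-mat : ∀ n m {Z X Y} (f : Hom X Y) (x : ℕ → ℕ → Hom Z X) →
             T₁ n (T₁ m f) ∘ mat n m x ≈ mat n m λ j i → t j (t i f) ∘ mat j i x
  T₁T₁-mat n m f x = ≈.trans (T₁-seq n (T₁ m f) _) (seq-cong n λ j → seq-unique m _ λ i → begin
    p i ∘ (t j (T₁ m f) ∘ mat j m x)
      ≈⟨ assoc ⟨
    (p i ∘ t j (T₁ m f)) ∘ mat j m x
      ≈⟨ ∘-congʳ (t-∘-linearˡ j (T₁ m f) (linear-p i)) ⟨
    t j (p i ∘ T₁ m f) ∘ mat j m x
      ≈⟨ ∘-congʳ (t-cong j (p-T₁ m f i)) ⟩
    t j (t (toℕ i) f ∘ s (toℕ≤pred[n] i)) ∘ mat j m x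
      ≈⟨ t-∘-linearʳ j (t (toℕ i) f) (D-s (toℕ≤pred[n] i)) _ ⟩
    t j (t (toℕ i) f) ∘ seq j (λ b → s (toℕ≤pred[n] i) ∘ seq m (x b))
      ≈⟨ ∘-congˡ (seq-cong j (λ b → s-seq (toℕ≤pred[n] i) (x b))) ⟩
    t j (t (toℕ i) f) ∘ mat j (toℕ i) x
      ∎)

  ι-coord : ∀ {X} → ℕ → Hom X X
  ι-coord zero    = idm
  ι-coord (suc _) = 𝟎

  ι-seq : ∀ n {X} → ι n X ≈ seq n ι-coord
  ι-seq n = seq-unique n _ λ
    { zero    → π-tuple {n} _ zero
    ; (suc i) → π-tuple {n} _ (suc i) }

  ι-natural : ∀ n → IsNatural Id (T n) (ι n)
  ι-natural n {X} {Y} f = begin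
    ι n Y ∘ f                             ≈⟨ ∘-congʳ (ι-seq n) ⟩
    seq n _ ∘ f                           ≈⟨ seq-∘ n _ f ⟩
    seq n _                               ≈⟨ seq-cong n (λ where
      zero    → ≈.trans identityˡ (≈.sym (≈.trans (∘-congˡ (seq-zero _)) identityʳ))
      (suc k) → ≈.trans (Additive.0ᴹ-homo (precomposition f)) (≈.sym (t-suc-ι k))) ⟩
    seq n (λ i → t i f ∘ seq i ι-coord)       ≈⟨ T₁-seq n f ι-coord ⟨
    T₁ n f ∘ seq n ι-coord                    ≈⟨ ∘-congˡ (ι-seq n) ⟨
    T₁ n f ∘ ι n X                        ∎
    where
      seq-𝟎 : ∀ k → seq k (∂ k ι-coord) ≈ 𝟎
      seq-𝟎 k = ≈.sym (seq-unique k _ λ i →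
        ≈.trans (Additive.0ᴹ-homo (π-additive {k} (λ _ → X) i)) (≈.sym (hom.*ₗ-zeroʳ _)))

      -- `∂` discards entry `0`, the only one of `ι-coord` that is not `𝟎`, so the direction
      -- vanishes.
      t-suc-ι : ∀ k → t (suc k) f ∘ seq (suc k) ι-coord ≈ 𝟎
      t-suc-ι k = ≈.trans (t-suc-seq k f ι-coord) (≈.trans
        (∘-congˡ (⟨⟩-cong ≈.refl (seq-𝟎 k)))
        (Additive.0ᴹ-homo (D-additive₁ (t k f) _)))

  θ-mat : ∀ n {Z X} (x : ℕ → ℕ → Hom Z X) → θ n X ∘ mat n n x ≈ seq n (conv (flip x))
  θ-mat n {X = X} x = seq-unique n _ λ k → begin
    p k ∘ (θ n X ∘ mat n n x)
      ≈⟨ assoc ⟨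
    (p k ∘ θ n X) ∘ mat n n x
      ≈⟨ ∘-congʳ (π-tuple {n} _ k) ⟩
    sum (λ (i : Fin (suc (toℕ k))) →
      p (inject≤ i (toℕ<n k)) ∘ p (inject≤ (opposite i) (toℕ<n k))) ∘ mat n n x
      ≈⟨ sum-homo (precomposition _) (λ (i : Fin (suc (toℕ k))) →
           p (inject≤ i (toℕ<n k)) ∘ p (inject≤ (opposite i) (toℕ<n k))) ⟩
    sum (λ (i : Fin (suc (toℕ k))) →
      (p (inject≤ i (toℕ<n k)) ∘ p (inject≤ (opposite i) (toℕ<n k))) ∘ mat n n x)
      -- `opposite-prop` gives `suc (toℕ k) ∸ suc (toℕ i)`, which computes to the second index of
      -- `conv`.
      ≈⟨ Sum.sum-cong-≋ {n = suc (toℕ k)} (λ i → ≈.trans assoc (≈.trans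
           (∘-congˡ (p-seq (λ j → seq n (x j)) (inject≤ (opposite i) (toℕ<n k))))
           (≈.trans (p-seq (x _) (inject≤ i (toℕ<n k))) (≈.reflexive (≡.cong₂ x
             (≡.trans (toℕ-inject≤ (opposite i) (toℕ<n k)) (opposite-prop i))
             (toℕ-inject≤ i (toℕ<n k))))))) ⟩
    conv (flip x) (toℕ k)
      ∎

  -- Both sides are evaluated at the generic matrix, which is the identity by `mat-entry-idm`; the
  -- square then becomes `t-conv`.
  θ-natural : ∀ n → IsNatural (T n ∘F T n) (T n) (θ n)
  θ-natural n {X} {Y} f = begin
    θ n Y ∘ T₁ n (T₁ n f)                             ≈⟨ ∘-congˡ (∘-identity (mat-entry-idm n n)) ⟨
    θ n Y ∘ (T₁ n (T₁ n f) ∘ mat n n x)               ≈⟨ ∘-congˡ (T₁T₁-mat n n f x) ⟩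
    θ n Y ∘ mat n n (λ j i → t j (t i f) ∘ mat j i x) ≈⟨ θ-mat n _ ⟩
    seq n (conv (λ i j → t j (t i f) ∘ mat j i x))    ≈⟨ seq-cong n (λ k → t-conv k f x) ⟨
    seq n (λ k → t k f ∘ seq k (conv (flip x)))       ≈⟨ T₁-seq n f (conv (flip x)) ⟨
    T₁ n f ∘ seq n (conv (flip x))                    ≈⟨ ∘-congˡ (θ-mat n x) ⟨
    T₁ n f ∘ (θ n X ∘ mat n n x)                      ≈⟨ ∘-congˡ (∘-identity (mat-entry-idm n n)) ⟩
    T₁ n f ∘ θ n X                                    ∎
    where
      x : ℕ → ℕ → Hom _ X
      x = entry n n

  c-mat : ∀ n m {Z X} (x : ℕ → ℕ → Hom Z X) → c n m X ∘ mat n m x ≈ mat m n (flip x)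
  c-mat n m {X = X} x = seq-unique m _ λ j → ≈.trans (≈.sym assoc)
    (≈.trans (∘-congʳ (π-tuple {m} _ j)) (seq-unique n _ λ i → begin
      p i ∘ (tuple {n} (λ a → p j ∘ p a) ∘ mat n m x)  ≈⟨ assoc ⟨
      (p i ∘ tuple {n} (λ a → p j ∘ p a)) ∘ mat n m x  ≈⟨ ∘-congʳ (π-tuple {n} (λ a → p j ∘ p a) i) ⟩
      (p j ∘ p i) ∘ mat n m x                          ≈⟨ assoc ⟩
      p j ∘ (p i ∘ mat n m x)                          ≈⟨ ∘-congˡ (p-seq _ i) ⟩
      p j ∘ seq m (x (toℕ i))                          ≈⟨ p-seq _ j ⟩
      x (toℕ i) (toℕ j)                                ∎))

  -- At the generic matrix, `c` transposes and `t-swap` is all that remains.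
  c-natural : ∀ n m → IsNatural (T n ∘F T m) (T m ∘F T n) (c n m)
  c-natural n m {X} {Y} f = begin
    c n m Y ∘ T₁ n (T₁ m f)                                  ≈⟨ ∘-congˡ (∘-identity (mat-entry-idm n m)) ⟨
    c n m Y ∘ (T₁ n (T₁ m f) ∘ mat n m x)                    ≈⟨ ∘-congˡ (T₁T₁-mat n m f x) ⟩
    c n m Y ∘ mat n m (λ j i → t j (t i f) ∘ mat j i x)      ≈⟨ c-mat n m _ ⟩
    mat m n (λ i j → t j (t i f) ∘ mat j i x)                ≈⟨ mat-cong m n (λ i j → t-swap j i f x) ⟩
    mat m n (λ i j → t i (t j f) ∘ mat i j (flip x))         ≈⟨ T₁T₁-mat m n f (flip x) ⟨
    T₁ m (T₁ n f) ∘ mat m n (flip x)                         ≈⟨ ∘-congˡ (c-mat n m x) ⟨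
    T₁ m (T₁ n f) ∘ (c n m X ∘ mat n m x)                    ≈⟨ ∘-congˡ (∘-identity (mat-entry-idm n m)) ⟩
    T₁ m (T₁ n f) ∘ c n m X                                  ∎
    where
      x : ℕ → ℕ → Hom _ X
      x = entry n m

  scale-seq : ∀ n a {Z X} (x : ℕ → Hom Z X) → scale n a X ∘ seq n x ≈ seq n λ i → (a ^ i) · x i
  scale-seq n a x = seq-unique n _ λ i → ≈.trans (≈.sym assoc)
    (≈.trans (∘-congʳ (π-tuple {n} _ i))
      (≈.trans (·-∘ _ _ _) (hom.*ₗ-congˡ (p-seq x i))))

  scale-natural : ∀ n a → IsNatural (T n) (T n) (scale n a)
  scale-natural n a {X} {Y} f = begin
    scale n a Y ∘ T₁ n f                                     ≈⟨ ∘-congˡ (∘-identity (seq-coord n)) ⟨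
    scale n a Y ∘ (T₁ n f ∘ seq n x)                         ≈⟨ ∘-congˡ (T₁-seq n f x) ⟩
    scale n a Y ∘ seq n (λ i → t i f ∘ seq i x)              ≈⟨ scale-seq n a _ ⟩
    seq n (λ i → (a ^ i) · (t i f ∘ seq i x))                ≈⟨ seq-cong n (λ i → t-homogeneous i a f x) ⟨
    seq n (λ i → t i f ∘ seq i (λ k → (a ^ k) · x k))        ≈⟨ T₁-seq n f _ ⟨
    T₁ n f ∘ seq n (λ i → (a ^ i) · x i)                     ≈⟨ ∘-congˡ (scale-seq n a x) ⟨
    T₁ n f ∘ (scale n a X ∘ seq n x)                         ≈⟨ ∘-congˡ (∘-identity (seq-coord n)) ⟩
    T₁ n f ∘ scale n a X                                     ∎
    where
      x : ℕ → Hom _ X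
      x = coord n

theorem5 : ∀ {a ℓa o ℓ e} (R : CommutativeSemiring a ℓa) (inverses : IntegerInverses R)
    (𝒞 : CartesianDifferentialCategory R o ℓ e) →
    let open Taylor R inverses 𝒞 in
    (n m : ℕ) (r : CommutativeSemiring.Carrier R) →
    IsNatural Id (T n) (ι n)
    × IsNatural (T n ∘F T n) (T n) (θ n)
    × IsNatural (T n ∘F T m) (T m ∘F T n) (c n m)
    × IsNatural (T n) (T n) (scale n r)
theorem5 R inverses 𝒞 n m r =
  ι-natural n , θ-natural n , c-natural n m , scale-natural n r
  where open Naturality R inverses 𝒞
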